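{- Let $P$ be a semi-Eulerian poset of rank $n+1$. Then the modified chain polynomial $\chi'_P(a,b)$ admits a $cd$-index, i.e., there exists a polynomial $\Phi_P(c,d)$ in non-commuting variables $c$ and $d$ such that \[ \Phi_P(a+b,ab+ba)=\chi'_P(a-b,b). \]
   Context: All posets are finite and graded with a unique minimum $\hat 0$ and a unique maximum $\hat 1$. A poset $P$ is semi-Eulerian if every interval $[s,t]\neq[\hat0,\hat1]$ with more than one element has as many elements of odd rank as of even rank; it is Eulerian if moreover $P$ itself has this property. For $P$ of rank $n+1$ and $S=\{\ell_1<\dots<\ell_k\}\subseteq[n]$, $f_S(P)$ is the number of chains $\hat0<x_1<\dots<x_k<\hat1$ with $\mathrm{rk}(x_i)=\ell_i$ (so $f_\emptyset(P)=1$). The Euler characteristic is $\chi(P)=\sum_{j=1}^n(-1)^{j-1}f_{\{j\}}(P)$, and $\chi(\mathbb S^{n-1})=1-(-1)^n$. For $S\subseteq[n]$, $u_S=u_1\cdots u_n$ is the monomial in non-commuting variables $a,b$ with $u_i=b$ if $i\in S$ and $u_i=a$ otherwise. The modified flag $f$-vector is $f'_{\{n\}}(P)=f_{\{n\}}(P)+(\chi(\mathbb S^{n-1})-\chi(P))$ and $f'_S(P)=f_S(P)$ for $S\neq\{n\}$; the modified chain polynomial is $\chi'_P(a,b)=\sum_{S\subseteq[n]}f'_S(P)u_S$. -}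

module Defs where

open import Data.Nat as ℕ using (ℕ; zero; suc)
open import Data.Nat.Properties as ℕP using ()
open import Data.Integer as ℤ using (ℤ; +_; -_)
open import Data.Bool using (Bool; true; false; T; _∧_; not; if_then_else_)
open import Data.Fin using (Fin)
open import Data.Fin.Properties as FinP using ()
open import Data.List using (List; []; _∷_; _++_; map; concatMap; filter; length; foldr; upTo)
open import Data.List.Properties using (≡-dec)
open import Data.Vec as Vec using (Vec; []; _∷_)
open import Data.Fin using (Fin)
open import Data.Nat.ListAction using () renaming (sum to sumℕ)
open import Data.Empty using (⊥)
open import Data.Product using (Σ; _×_; _,_)
open import Relation.Nullary using (¬_; does; yes; no)
open import Relation.Binary.PropositionalEquality using (_≡_; _≢_; refl)
open import Relation.Binary.Definitions using (DecidableEquality)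

-- Non-commutative polynomials with integer coefficients, as formal sums
-- of terms (coefficient, word).  Two polynomials are equal (_≈_) when
-- every word has the same total coefficient.

NCPoly : Set → Set
NCPoly X = List (ℤ × List X)

sumℤ : List ℤ → ℤ
sumℤ = foldr ℤ._+_ (+ 0)

coeff : {X : Set} → DecidableEquality X → NCPoly X → List X → ℤ
coeff {X} eq p w = sumℤ (map term p)
  where
  term : ℤ × List X → ℤ
  term (c , u) with ≡-dec eq u w
  ... | yes _ = c
  ... | no  _ = + 0

_≈⟨_⟩_ : {X : Set} → NCPoly X → DecidableEquality X → NCPoly X → Set
p ≈⟨ eq ⟩ q = ∀ w → coeff eq p w ≡ coeff eq q w

oneₚ : {X : Set} → NCPoly X
oneₚ = (+ 1 , []) ∷ []

scaleₚ : {X : Set} → ℤ → NCPoly X → NCPoly X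
scaleₚ c = map (λ { (d , u) → (c ℤ.* d , u) })

_·ₚ_ : {X : Set} → NCPoly X → NCPoly X → NCPoly X
p ·ₚ q = concatMap (λ { (c , u) → map (λ { (d , v) → (c ℤ.* d , u ++ v) }) q }) p

substWord : {X Y : Set} → (X → NCPoly Y) → List X → NCPoly Y
substWord σ [] = oneₚ
substWord σ (x ∷ w) = σ x ·ₚ substWord σ w

substₚ : {X Y : Set} → (X → NCPoly Y) → NCPoly X → NCPoly Y
substₚ σ p = concatMap (λ { (c , w) → scaleₚ c (substWord σ w) }) p

data AB : Set where
  𝐚 𝐛 : AB

data CD : Set where
  𝐜 𝐝 : CD

_≟AB_ : DecidableEquality AB
𝐚 ≟AB 𝐚 = yes refl
𝐚 ≟AB 𝐛 = no (λ ())
𝐛 ≟AB 𝐚 = no (λ ())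
𝐛 ≟AB 𝐛 = yes refl

σcd : CD → NCPoly AB
σcd 𝐜 = (+ 1 , 𝐚 ∷ []) ∷ (+ 1 , 𝐛 ∷ []) ∷ []
σcd 𝐝 = (+ 1 , 𝐚 ∷ 𝐛 ∷ []) ∷ (+ 1 , 𝐛 ∷ 𝐚 ∷ []) ∷ []

σab : AB → NCPoly AB
σab 𝐚 = (+ 1 , 𝐚 ∷ []) ∷ (- (+ 1) , 𝐛 ∷ []) ∷ []
σab 𝐛 = (+ 1 , 𝐛 ∷ []) ∷ []

-- Elements are Fin card; the order
-- is a Bool-valued relation; gradedness is given by a rank function with
-- rk 0̂ = 0 and rk y = rk x + 1 whenever y covers x.

record GradedPoset : Set where
  field
    card  : ℕ
    le    : Fin card → Fin card → Bool
    le-refl    : ∀ x → T (le x x)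
    le-antisym : ∀ x y → T (le x y) → T (le y x) → x ≡ y
    le-trans   : ∀ x y z → T (le x y) → T (le y z) → T (le x z)
    bot top : Fin card
    bot-min : ∀ x → T (le bot x)
    top-max : ∀ x → T (le x top)
    rk : Fin card → ℕ
    rk-bot : rk bot ≡ 0
    rk-cover : ∀ x y → T (le x y) → x ≢ y →
               (∀ z → T (le x z) → x ≢ z → T (le z y) → z ≢ y → ⊥) →
               rk y ≡ suc (rk x)

  lt : Fin card → Fin card → Bool
  lt x y = le x y ∧ not (does (x FinP.≟ y))

  elems : List (Fin card)
  elems = Data.List.allFin card
    where import Data.List

  countWhere : (Fin card → Bool) → ℕ
  countWhere p = length (filter (λ z → T? (p z)) elems)
    where
    open import Relation.Nullary.Decidable using () renaming (T? to T?)

open GradedPoset public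

evenB : ℕ → Bool
evenB zero = true
evenB (suc k) = not (evenB k)

nEvenIn nOddIn : (P : GradedPoset) → Fin (card P) → Fin (card P) → ℕ
nEvenIn P s t = countWhere P (λ z → le P s z ∧ le P z t ∧ evenB (rk P z))
nOddIn  P s t = countWhere P (λ z → le P s z ∧ le P z t ∧ not (evenB (rk P z)))

SemiEulerian : GradedPoset → Set
SemiEulerian P = ∀ s t → T (le P s t) → s ≢ t → ¬ (s ≡ bot P × t ≡ top P) →
                 nEvenIn P s t ≡ nOddIn P s t

chainsFrom : (P : GradedPoset) → Fin (card P) → List ℕ → ℕ
chainsFrom P x [] = if lt P x (top P) then 1 else 0
chainsFrom P x (ℓ ∷ ℓs) =
  sumℕ (map (λ y → if lt P x y ∧ does (rk P y ℕ.≟ ℓ) then chainsFrom P y ℓs else 0)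
            (elems P))

-- subsets S ⊆ [n] as Vec Bool n, entry i (0-based) meaning rank i+1 ∈ S
ranksFrom : {n : ℕ} → ℕ → Vec Bool n → List ℕ
ranksFrom k [] = []
ranksFrom k (true ∷ v) = suc k ∷ ranksFrom (suc k) v
ranksFrom k (false ∷ v) = ranksFrom (suc k) v

ranks : {n : ℕ} → Vec Bool n → List ℕ
ranks = ranksFrom 0

allSubsets : (n : ℕ) → List (Vec Bool n)
allSubsets zero = [] ∷ []
allSubsets (suc n) = map (true ∷_) (allSubsets n) ++ map (false ∷_) (allSubsets n)

flagF : (P : GradedPoset) {n : ℕ} → Vec Bool n → ℕ
flagF P S = chainsFrom P (bot P) (ranks S)

uS : {n : ℕ} → Vec Bool n → List AB
uS S = Vec.toList (Vec.map (λ β → if β then 𝐛 else 𝐚) S)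

negOnePow : ℕ → ℤ
negOnePow zero = + 1
negOnePow (suc k) = - negOnePow k

eulerChar : GradedPoset → ℕ → ℤ
eulerChar P n = sumℤ (map (λ j → negOnePow j ℤ.* + chainsFrom P (bot P) (suc j ∷ []))
                          (upTo n))

chiSphere : ℕ → ℤ
chiSphere n = + 1 ℤ.- negOnePow n

flagF' : (P : GradedPoset) (n : ℕ) → Vec Bool n → ℤ
flagF' P n S with ≡-dec ℕ._≟_ (ranks S) (n ∷ [])
... | yes _ = + flagF P S ℤ.+ (chiSphere n ℤ.- eulerChar P n)
... | no  _ = + flagF P S

-- modified chain polynomial χ'_P(a,b), for P of rank n+1
chainPoly' : GradedPoset → ℕ → NCPoly AB
chainPoly' P n = map (λ S → (flagF' P n S , uS S)) (allSubsets n)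

{-# OPTIONS --safe #-}

-- Following Bayer and Klapper, a function F on ab-words of length n has a cd-index as soon as it
-- satisfies the generalized Dehn–Sommerville relations: writing the cd-index as c Φ' + d Φ'' and
-- comparing coefficients determines the h-vectors of Φ' and Φ'', and the relations pass to them.
-- For the flag f-vector of a semi-Eulerian poset, a relation splits over the pairs x < y of elements
-- bounding its gap of ranks and reduces to the Euler relation of the interval [x, y].  Only the
-- relation for [0̂, 1̂] itself can fail, by exactly χ(S^(n-1)) - χ(P), which the modified entry
-- f'_{n} compensates; for even n this defect vanishes, by counting the pairs 0̂ < z < y < 1̂ twice.

module Submission where

open import Defs
open import Data.Bool as Bool using (Bool; true; false; T; _∧_; not; if_then_else_)
open import Data.Bool.Properties using (T-≡; ∧-zeroʳ; ∧-identityʳ; ∧-conicalˡ; ∧-conicalʳ; ¬-not)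
open import Data.Empty using (⊥; ⊥-elim)
open import Data.Fin using (Fin)
import Data.Fin as Fin
import Data.Fin.Properties as Fin
open import Data.Integer using (ℤ; +_; -_; _+_; _*_; _-_; 0ℤ; 1ℤ)
import Data.Integer.Properties as ℤ
open import Data.Integer.Tactic.RingSolver using (solve-∀)
open import Data.List using (List; []; _∷_; _++_; map; length; replicate; filter; allFin; tabulate; upTo; null)
open import Data.List.Properties
  using (≡-dec; map-++; map-∘; map-cong; concatMap-++; ++-identityʳ; length-++; length-replicate;
         map-tabulate; upTo-∷ʳ; ∷-injective)
open import Data.List.Membership.Propositional using (_∈_)
open import Data.List.Membership.Propositional.Properties using (∈-allFin)
open import Data.List.Relation.Unary.Any using (here; there)
open import Data.Nat as ℕ using (ℕ; zero; suc)
import Data.Nat.Properties as ℕ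
import Data.Nat.Tactic.RingSolver as ℕ-Solver
open import Data.Nat.ListAction using () renaming (sum to sumℕ)
open import Data.Product using (Σ; _×_; _,_; proj₁; proj₂)
open import Data.Vec as Vec using (Vec; []; _∷_)
open import Function using (_∘_; id; Equivalence; case_of_)
open import Relation.Binary.Definitions using (DecidableEquality; tri<; tri≈; tri>)
open import Relation.Binary.PropositionalEquality
open import Relation.Nullary using (¬_; Dec; yes; no; does)
open import Relation.Nullary.Decidable using (T?; dec-true; dec-false)
open ≡-Reasoning

∑ : {X : Set} → List X → (X → ℤ) → ℤ
∑ []       f = 0ℤ
∑ (x ∷ xs) f = f x + ∑ xs f

infix 9 ∑
syntax ∑ xs (λ x → e) = ∑[ x ← xs ] e

module _ {X : Set} where

  ∑-cong : ∀ (xs : List X) {f g : X → ℤ} → (∀ x → f x ≡ g x) → ∑ xs f ≡ ∑ xs g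
  ∑-cong []       f≗g = refl
  ∑-cong (x ∷ xs) f≗g = cong₂ _+_ (f≗g x) (∑-cong xs f≗g)

  ∑-zero : ∀ (xs : List X) {f : X → ℤ} → (∀ x → f x ≡ 0ℤ) → ∑ xs f ≡ 0ℤ
  ∑-zero []       f≗0 = refl
  ∑-zero (x ∷ xs) f≗0 = cong₂ _+_ (f≗0 x) (∑-zero xs f≗0)

  ∑-++ : ∀ (xs ys : List X) f → ∑ (xs ++ ys) f ≡ ∑ xs f + ∑ ys f
  ∑-++ []       ys f = sym (ℤ.+-identityˡ _)
  ∑-++ (x ∷ xs) ys f = trans (cong (_+_ (f x)) (∑-++ xs ys f)) (sym (ℤ.+-assoc (f x) _ _))

  ∑-+ : ∀ (xs : List X) f g → ∑[ x ← xs ] (f x + g x) ≡ ∑ xs f + ∑ xs g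
  ∑-+ []       f g = refl
  ∑-+ (x ∷ xs) f g = trans (cong (_+_ (f x + g x)) (∑-+ xs f g)) (interchange (f x) (g x) _ _)
    where
    interchange : ∀ a b c d → a + b + (c + d) ≡ a + c + (b + d)
    interchange = solve-∀

  ∑-*ˡ : ∀ (xs : List X) k f → ∑[ x ← xs ] (k * f x) ≡ k * ∑ xs f
  ∑-*ˡ []       k f = sym (ℤ.*-zeroʳ k)
  ∑-*ˡ (x ∷ xs) k f = trans (cong (_+_ (k * f x)) (∑-*ˡ xs k f)) (sym (ℤ.*-distribˡ-+ k _ _))

  ∑-*ʳ : ∀ (xs : List X) k f → ∑[ x ← xs ] (f x * k) ≡ ∑ xs f * k
  ∑-*ʳ xs k f = begin
    ∑[ x ← xs ] (f x * k) ≡⟨ ∑-cong xs (λ x → ℤ.*-comm (f x) k) ⟩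
    ∑[ x ← xs ] (k * f x) ≡⟨ ∑-*ˡ xs k f ⟩
    k * ∑ xs f            ≡⟨ ℤ.*-comm k _ ⟩
    ∑ xs f * k            ∎

  ∑-neg : ∀ (xs : List X) f → ∑[ x ← xs ] (- f x) ≡ - ∑ xs f
  ∑-neg []       f = refl
  ∑-neg (x ∷ xs) f = trans (cong (_+_ (- f x)) (∑-neg xs f)) (sym (ℤ.neg-distrib-+ (f x) _))

  ∑-sub : ∀ (xs : List X) f g → ∑[ x ← xs ] (f x - g x) ≡ ∑ xs f - ∑ xs g
  ∑-sub xs f g = trans (∑-+ xs f (-_ ∘ g)) (cong (_+_ (∑ xs f)) (∑-neg xs g))

∑-map : ∀ {X Y : Set} (h : X → Y) (xs : List X) f → ∑ (map h xs) f ≡ ∑ xs (f ∘ h)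
∑-map h []       f = refl
∑-map h (x ∷ xs) f = cong (_+_ (f (h x))) (∑-map h xs f)

∑-swap : ∀ {X Y : Set} (xs : List X) (ys : List Y) (f : X → Y → ℤ) →
         ∑[ x ← xs ] ∑ ys (f x) ≡ ∑[ y ← ys ] ∑[ x ← xs ] f x y
∑-swap []       ys f = sym (∑-zero ys (λ _ → refl))
∑-swap (x ∷ xs) ys f =
  trans (cong (_+_ (∑ ys (f x))) (∑-swap xs ys f)) (sym (∑-+ ys (f x) (λ y → ∑[ x ← xs ] f x y)))

coeffAB : NCPoly AB → List AB → ℤ
coeffAB = coeff _≟AB_

_≟ʷ_ : DecidableEquality (List AB)
_≟ʷ_ = ≡-dec _≟AB_

monoCoeff : ℤ → List AB → List AB → ℤ
monoCoeff c u w = if does (u ≟ʷ w) then c else 0ℤ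

coeff-∷ : ∀ c u p w → coeffAB ((c , u) ∷ p) w ≡ monoCoeff c u w + coeffAB p w
coeff-∷ c u p w with u ≟ʷ w
... | yes _ = refl
... | no  _ = refl

coeff-++ : ∀ p q w → coeffAB (p ++ q) w ≡ coeffAB p w + coeffAB q w
coeff-++ []            q w = sym (ℤ.+-identityˡ _)
coeff-++ ((c , u) ∷ p) q w = begin
  coeffAB ((c , u) ∷ p ++ q) w               ≡⟨ coeff-∷ c u (p ++ q) w ⟩
  monoCoeff c u w + coeffAB (p ++ q) w       ≡⟨ cong (_+_ (monoCoeff c u w)) (coeff-++ p q w) ⟩
  monoCoeff c u w + (coeffAB p w + coeffAB q w) ≡⟨ sym (ℤ.+-assoc (monoCoeff c u w) _ _) ⟩
  monoCoeff c u w + coeffAB p w + coeffAB q w   ≡⟨ cong (_+ coeffAB q w) (sym (coeff-∷ c u p w)) ⟩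
  coeffAB ((c , u) ∷ p) w + coeffAB q w      ∎

monoCoeff-* : ∀ k c u w → monoCoeff (k * c) u w ≡ k * monoCoeff c u w
monoCoeff-* k c u w with u ≟ʷ w
... | yes _ = refl
... | no  _ = sym (ℤ.*-zeroʳ k)

coeff-scale : ∀ k p w → coeffAB (scaleₚ k p) w ≡ k * coeffAB p w
coeff-scale k []            w = sym (ℤ.*-zeroʳ k)
coeff-scale k ((c , u) ∷ p) w = begin
  coeffAB ((k * c , u) ∷ scaleₚ k p) w             ≡⟨ coeff-∷ (k * c) u (scaleₚ k p) w ⟩
  monoCoeff (k * c) u w + coeffAB (scaleₚ k p) w    ≡⟨ cong₂ _+_ (monoCoeff-* k c u w) (coeff-scale k p w) ⟩
  k * monoCoeff c u w + k * coeffAB p w            ≡⟨ sym (ℤ.*-distribˡ-+ k _ _) ⟩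
  k * (monoCoeff c u w + coeffAB p w)              ≡⟨ cong (k *_) (sym (coeff-∷ c u p w)) ⟩
  k * coeffAB ((c , u) ∷ p) w                      ∎

-- coeffAfter u q w is the coefficient of w in the product u · q.
coeffAfter : List AB → NCPoly AB → List AB → ℤ
coeffAfter []      q w       = coeffAB q w
coeffAfter (_ ∷ _) q []      = 0ℤ
coeffAfter (x ∷ u) q (y ∷ w) = if does (x ≟AB y) then coeffAfter u q w else 0ℤ

monoCoeff-∷ : ∀ x c u w → monoCoeff c (x ∷ u) (x ∷ w) ≡ monoCoeff c u w
monoCoeff-∷ 𝐚 c u w with u ≟ʷ w
... | yes _ = refl
... | no  _ = refl
monoCoeff-∷ 𝐛 c u w with u ≟ʷ w
... | yes _ = refl
... | no  _ = refl

coeffAfter-∷ : ∀ u d v q w → coeffAfter u ((d , v) ∷ q) w ≡ monoCoeff d (u ++ v) w + coeffAfter u q w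
coeffAfter-∷ []      d v q w       = coeff-∷ d v q w
coeffAfter-∷ (x ∷ u) d v q []      = refl
coeffAfter-∷ (𝐚 ∷ u) d v q (𝐛 ∷ w) = refl
coeffAfter-∷ (𝐛 ∷ u) d v q (𝐚 ∷ w) = refl
coeffAfter-∷ (𝐚 ∷ u) d v q (𝐚 ∷ w) =
  trans (coeffAfter-∷ u d v q w) (cong (_+ coeffAfter u q w) (sym (monoCoeff-∷ 𝐚 d (u ++ v) w)))
coeffAfter-∷ (𝐛 ∷ u) d v q (𝐛 ∷ w) =
  trans (coeffAfter-∷ u d v q w) (cong (_+ coeffAfter u q w) (sym (monoCoeff-∷ 𝐛 d (u ++ v) w)))

coeffAfter-[] : ∀ u w → coeffAfter u [] w ≡ 0ℤ
coeffAfter-[] []      w       = refl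
coeffAfter-[] (x ∷ u) []      = refl
coeffAfter-[] (x ∷ u) (y ∷ w) with x ≟AB y
... | yes _ = coeffAfter-[] u w
... | no  _ = refl

coeffAfter-++ : ∀ u p q w → coeffAfter u (p ++ q) w ≡ coeffAfter u p w + coeffAfter u q w
coeffAfter-++ []      p q w       = coeff-++ p q w
coeffAfter-++ (x ∷ u) p q []      = refl
coeffAfter-++ (x ∷ u) p q (y ∷ w) with x ≟AB y
... | yes _ = coeffAfter-++ u p q w
... | no  _ = refl

coeffAfter-scale : ∀ k u p w → coeffAfter u (scaleₚ k p) w ≡ k * coeffAfter u p w
coeffAfter-scale k []      p w       = coeff-scale k p w
coeffAfter-scale k (x ∷ u) p []      = sym (ℤ.*-zeroʳ k)
coeffAfter-scale k (x ∷ u) p (y ∷ w) with x ≟AB y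
... | yes _ = coeffAfter-scale k u p w
... | no  _ = sym (ℤ.*-zeroʳ k)

·ₚ-∷ : ∀ t (p q : NCPoly AB) → (t ∷ p) ·ₚ q ≡ (t ∷ []) ·ₚ q ++ p ·ₚ q
·ₚ-∷ t p q = cong (_++ p ·ₚ q) (sym (++-identityʳ _))

coeff-·-∷ : ∀ c u p q w → coeffAB (((c , u) ∷ p) ·ₚ q) w ≡ c * coeffAfter u q w + coeffAB (p ·ₚ q) w
coeff-·-∷ c u p q w = begin
  coeffAB (((c , u) ∷ p) ·ₚ q) w                        ≡⟨ cong (λ r → coeffAB r w) (·ₚ-∷ (c , u) p q) ⟩
  coeffAB (((c , u) ∷ []) ·ₚ q ++ p ·ₚ q) w             ≡⟨ coeff-++ (((c , u) ∷ []) ·ₚ q) (p ·ₚ q) w ⟩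
  coeffAB (((c , u) ∷ []) ·ₚ q) w + coeffAB (p ·ₚ q) w  ≡⟨ cong (_+ coeffAB (p ·ₚ q) w) (monomial q) ⟩
  c * coeffAfter u q w + coeffAB (p ·ₚ q) w             ∎
  where
  monomial : ∀ q → coeffAB (((c , u) ∷ []) ·ₚ q) w ≡ c * coeffAfter u q w
  monomial []            = sym (trans (cong (c *_) (coeffAfter-[] u w)) (ℤ.*-zeroʳ c))
  monomial ((d , v) ∷ q) = begin
    coeffAB ((c * d , u ++ v) ∷ ((c , u) ∷ []) ·ₚ q) w
      ≡⟨ coeff-∷ (c * d) (u ++ v) (((c , u) ∷ []) ·ₚ q) w ⟩
    monoCoeff (c * d) (u ++ v) w + coeffAB (((c , u) ∷ []) ·ₚ q) w
      ≡⟨ cong₂ _+_ (monoCoeff-* c d (u ++ v) w) (monomial q) ⟩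
    c * monoCoeff d (u ++ v) w + c * coeffAfter u q w           ≡⟨ sym (ℤ.*-distribˡ-+ c _ _) ⟩
    c * (monoCoeff d (u ++ v) w + coeffAfter u q w)             ≡⟨ cong (c *_) (sym (coeffAfter-∷ u d v q w)) ⟩
    c * coeffAfter u ((d , v) ∷ q) w                            ∎

coeff-·-[]ʳ : ∀ r w → coeffAB (r ·ₚ []) w ≡ 0ℤ
coeff-·-[]ʳ []            w = refl
coeff-·-[]ʳ ((c , u) ∷ r) w = begin
  coeffAB (((c , u) ∷ r) ·ₚ []) w              ≡⟨ coeff-·-∷ c u r [] w ⟩
  c * coeffAfter u [] w + coeffAB (r ·ₚ []) w
    ≡⟨ cong₂ (λ x y → c * x + y) (coeffAfter-[] u w) (coeff-·-[]ʳ r w) ⟩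
  c * 0ℤ + 0ℤ                                  ≡⟨ cong (_+ 0ℤ) (ℤ.*-zeroʳ c) ⟩
  0ℤ                                           ∎

coeff-·-++ʳ : ∀ r p q w → coeffAB (r ·ₚ (p ++ q)) w ≡ coeffAB (r ·ₚ p) w + coeffAB (r ·ₚ q) w
coeff-·-++ʳ []            p q w = refl
coeff-·-++ʳ ((c , u) ∷ r) p q w = begin
  coeffAB (((c , u) ∷ r) ·ₚ (p ++ q)) w                         ≡⟨ coeff-·-∷ c u r (p ++ q) w ⟩
  c * coeffAfter u (p ++ q) w + coeffAB (r ·ₚ (p ++ q)) w
    ≡⟨ cong₂ (λ x y → c * x + y) (coeffAfter-++ u p q w) (coeff-·-++ʳ r p q w) ⟩
  c * (coeffAfter u p w + coeffAfter u q w) + (coeffAB (r ·ₚ p) w + coeffAB (r ·ₚ q) w)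
    ≡⟨ distrib c (coeffAfter u p w) (coeffAfter u q w) _ _ ⟩
  (c * coeffAfter u p w + coeffAB (r ·ₚ p) w) + (c * coeffAfter u q w + coeffAB (r ·ₚ q) w)
    ≡⟨ sym (cong₂ _+_ (coeff-·-∷ c u r p w) (coeff-·-∷ c u r q w)) ⟩
  coeffAB (((c , u) ∷ r) ·ₚ p) w + coeffAB (((c , u) ∷ r) ·ₚ q) w ∎
  where
  distrib : ∀ c x y s t → c * (x + y) + (s + t) ≡ (c * x + s) + (c * y + t)
  distrib = solve-∀

coeff-·-scaleʳ : ∀ k r p w → coeffAB (r ·ₚ scaleₚ k p) w ≡ k * coeffAB (r ·ₚ p) w
coeff-·-scaleʳ k []            p w = sym (ℤ.*-zeroʳ k)
coeff-·-scaleʳ k ((c , u) ∷ r) p w = begin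
  coeffAB (((c , u) ∷ r) ·ₚ scaleₚ k p) w                       ≡⟨ coeff-·-∷ c u r (scaleₚ k p) w ⟩
  c * coeffAfter u (scaleₚ k p) w + coeffAB (r ·ₚ scaleₚ k p) w
    ≡⟨ cong₂ (λ x y → c * x + y) (coeffAfter-scale k u p w) (coeff-·-scaleʳ k r p w) ⟩
  c * (k * coeffAfter u p w) + k * coeffAB (r ·ₚ p) w             ≡⟨ distrib c k (coeffAfter u p w) _ ⟩
  k * (c * coeffAfter u p w + coeffAB (r ·ₚ p) w)                ≡⟨ cong (k *_) (sym (coeff-·-∷ c u r p w)) ⟩
  k * coeffAB (((c , u) ∷ r) ·ₚ p) w                            ∎
  where
  distrib : ∀ c k x y → c * (k * x) + k * y ≡ k * (c * x + y)
  distrib = solve-∀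

coeff-binomial-· : ∀ c₁ u₁ c₂ u₂ q w →
  coeffAB (((c₁ , u₁) ∷ (c₂ , u₂) ∷ []) ·ₚ q) w ≡ c₁ * coeffAfter u₁ q w + c₂ * coeffAfter u₂ q w
coeff-binomial-· c₁ u₁ c₂ u₂ q w =
  trans (coeff-·-∷ c₁ u₁ ((c₂ , u₂) ∷ []) q w)
        (cong (_+_ (c₁ * coeffAfter u₁ q w)) (trans (coeff-·-∷ c₂ u₂ [] q w) (ℤ.+-identityʳ _)))

coeff-subst-++ : ∀ {X} (σ : X → NCPoly AB) p q w →
  coeffAB (substₚ σ (p ++ q)) w ≡ coeffAB (substₚ σ p) w + coeffAB (substₚ σ q) w
coeff-subst-++ σ p q w =
  trans (cong (λ r → coeffAB r w) (concatMap-++ _ p q)) (coeff-++ (substₚ σ p) (substₚ σ q) w)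

_◃_ : {X : Set} → X → NCPoly X → NCPoly X
x ◃ p = map (λ { (k , v) → (k , x ∷ v) }) p

coeff-subst-◃ : ∀ {X} (σ : X → NCPoly AB) x p w →
  coeffAB (substₚ σ (x ◃ p)) w ≡ coeffAB (σ x ·ₚ substₚ σ p) w
coeff-subst-◃ σ x []            w = sym (coeff-·-[]ʳ (σ x) w)
coeff-subst-◃ σ x ((k , v) ∷ p) w = begin
  coeffAB (scaleₚ k (σ x ·ₚ substWord σ v) ++ substₚ σ (x ◃ p)) w
    ≡⟨ coeff-++ (scaleₚ k (σ x ·ₚ substWord σ v)) (substₚ σ (x ◃ p)) w ⟩
  coeffAB (scaleₚ k (σ x ·ₚ substWord σ v)) w + coeffAB (substₚ σ (x ◃ p)) w
    ≡⟨ cong₂ _+_ (coeff-scale k (σ x ·ₚ substWord σ v) w) (coeff-subst-◃ σ x p w) ⟩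
  k * coeffAB (σ x ·ₚ substWord σ v) w + coeffAB (σ x ·ₚ substₚ σ p) w
    ≡⟨ cong (_+ coeffAB (σ x ·ₚ substₚ σ p) w) (sym (coeff-·-scaleʳ k (σ x) (substWord σ v) w)) ⟩
  coeffAB (σ x ·ₚ scaleₚ k (substWord σ v)) w + coeffAB (σ x ·ₚ substₚ σ p) w
    ≡⟨ sym (coeff-·-++ʳ (σ x) (scaleₚ k (substWord σ v)) (substₚ σ p) w) ⟩
  coeffAB (σ x ·ₚ substₚ σ ((k , v) ∷ p)) w ∎

unit-coeffs-+ : ∀ x y → 1ℤ * x + 1ℤ * y ≡ x + y
unit-coeffs-+ x y = cong₂ _+_ (ℤ.*-identityˡ x) (ℤ.*-identityˡ y)

coeff-σcd𝐜-· : ∀ q w → coeffAB (σcd 𝐜 ·ₚ q) w ≡ coeffAfter (𝐚 ∷ []) q w + coeffAfter (𝐛 ∷ []) q w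
coeff-σcd𝐜-· q w =
  trans (coeff-binomial-· 1ℤ (𝐚 ∷ []) 1ℤ (𝐛 ∷ []) q w)
        (unit-coeffs-+ (coeffAfter (𝐚 ∷ []) q w) (coeffAfter (𝐛 ∷ []) q w))

coeff-σcd𝐝-· : ∀ q w → coeffAB (σcd 𝐝 ·ₚ q) w ≡ coeffAfter (𝐚 ∷ 𝐛 ∷ []) q w + coeffAfter (𝐛 ∷ 𝐚 ∷ []) q w
coeff-σcd𝐝-· q w =
  trans (coeff-binomial-· 1ℤ (𝐚 ∷ 𝐛 ∷ []) 1ℤ (𝐛 ∷ 𝐚 ∷ []) q w)
        (unit-coeffs-+ (coeffAfter (𝐚 ∷ 𝐛 ∷ []) q w) (coeffAfter (𝐛 ∷ 𝐚 ∷ []) q w))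

coeff-σcd𝐜-∷ : ∀ q y w → coeffAB (σcd 𝐜 ·ₚ q) (y ∷ w) ≡ coeffAB q w
coeff-σcd𝐜-∷ q 𝐚 w = trans (coeff-σcd𝐜-· q (𝐚 ∷ w)) (ℤ.+-identityʳ (coeffAB q w))
coeff-σcd𝐜-∷ q 𝐛 w = trans (coeff-σcd𝐜-· q (𝐛 ∷ w)) (ℤ.+-identityˡ (coeffAB q w))

coeff-σcd𝐝-∷∷ : ∀ q x y w → coeffAB (σcd 𝐝 ·ₚ q) (x ∷ y ∷ w) ≡ (if does (x ≟AB y) then 0ℤ else coeffAB q w)
coeff-σcd𝐝-∷∷ q 𝐚 𝐚 w = coeff-σcd𝐝-· q (𝐚 ∷ 𝐚 ∷ w)
coeff-σcd𝐝-∷∷ q 𝐚 𝐛 w = trans (coeff-σcd𝐝-· q (𝐚 ∷ 𝐛 ∷ w)) (ℤ.+-identityʳ (coeffAB q w))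
coeff-σcd𝐝-∷∷ q 𝐛 𝐚 w = trans (coeff-σcd𝐝-· q (𝐛 ∷ 𝐚 ∷ w)) (ℤ.+-identityˡ (coeffAB q w))
coeff-σcd𝐝-∷∷ q 𝐛 𝐛 w = coeff-σcd𝐝-· q (𝐛 ∷ 𝐛 ∷ w)

coeff-σab𝐚-· : ∀ q w → coeffAB (σab 𝐚 ·ₚ q) w ≡ coeffAfter (𝐚 ∷ []) q w - coeffAfter (𝐛 ∷ []) q w
coeff-σab𝐚-· q w = trans (coeff-binomial-· 1ℤ (𝐚 ∷ []) (- 1ℤ) (𝐛 ∷ []) q w)
                         (unit-coeffs (coeffAfter (𝐚 ∷ []) q w) (coeffAfter (𝐛 ∷ []) q w))
  where
  unit-coeffs : ∀ x y → 1ℤ * x + - 1ℤ * y ≡ x - y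
  unit-coeffs = solve-∀

coeff-σab𝐛-· : ∀ q w → coeffAB (σab 𝐛 ·ₚ q) w ≡ coeffAfter (𝐛 ∷ []) q w
coeff-σab𝐛-· q w = trans (coeff-·-∷ 1ℤ (𝐛 ∷ []) [] q w) (trans (ℤ.+-identityʳ _) (ℤ.*-identityˡ _))

-- The flag h-vector

flagH : ℕ → (List AB → ℤ) → List AB → ℤ
flagH zero    F []      = F []
flagH zero    F (_ ∷ _) = 0ℤ
flagH (suc n) F []      = 0ℤ
flagH (suc n) F (𝐚 ∷ w) = flagH n (F ∘ (𝐚 ∷_)) w
flagH (suc n) F (𝐛 ∷ w) = flagH n (F ∘ (𝐛 ∷_)) w - flagH n (F ∘ (𝐚 ∷_)) w

coeff-subst-flagH-zero : ∀ {X} (σ : X → NCPoly AB) F w →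
                         coeffAB (substₚ σ ((F [] , []) ∷ [])) w ≡ flagH zero F w
coeff-subst-flagH-zero σ F []      = trans (ℤ.+-identityʳ _) (ℤ.*-identityʳ (F []))
coeff-subst-flagH-zero σ F (_ ∷ _) = refl

flagH-cong : ∀ n {F G} w → (∀ v → length v ≡ n → F v ≡ G v) → flagH n F w ≡ flagH n G w
flagH-cong zero    []      F≗G = F≗G [] refl
flagH-cong zero    (_ ∷ _) F≗G = refl
flagH-cong (suc n) []      F≗G = refl
flagH-cong (suc n) (𝐚 ∷ w) F≗G = flagH-cong n w (λ v ∣v∣ → F≗G (𝐚 ∷ v) (cong suc ∣v∣))
flagH-cong (suc n) (𝐛 ∷ w) F≗G = cong₂ _-_ (flagH-cong n w (λ v ∣v∣ → F≗G (𝐛 ∷ v) (cong suc ∣v∣)))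
                                           (flagH-cong n w (λ v ∣v∣ → F≗G (𝐚 ∷ v) (cong suc ∣v∣)))

flagH-+ : ∀ n F G w → flagH n (λ v → F v + G v) w ≡ flagH n F w + flagH n G w
flagH-+ zero    F G []      = refl
flagH-+ zero    F G (_ ∷ _) = refl
flagH-+ (suc n) F G []      = refl
flagH-+ (suc n) F G (𝐚 ∷ w) = flagH-+ n (F ∘ (𝐚 ∷_)) (G ∘ (𝐚 ∷_)) w
flagH-+ (suc n) F G (𝐛 ∷ w) =
  trans (cong₂ _-_ (flagH-+ n (F ∘ (𝐛 ∷_)) (G ∘ (𝐛 ∷_)) w) (flagH-+ n (F ∘ (𝐚 ∷_)) (G ∘ (𝐚 ∷_)) w))
        (interchange (flagH n (F ∘ (𝐛 ∷_)) w) (flagH n (G ∘ (𝐛 ∷_)) w)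
                     (flagH n (F ∘ (𝐚 ∷_)) w) (flagH n (G ∘ (𝐚 ∷_)) w))
  where
  interchange : ∀ a b c d → a + b - (c + d) ≡ (a - c) + (b - d)
  interchange = solve-∀

flagH-*ˡ : ∀ n k F w → flagH n (λ v → k * F v) w ≡ k * flagH n F w
flagH-*ˡ zero    k F []      = refl
flagH-*ˡ zero    k F (_ ∷ _) = sym (ℤ.*-zeroʳ k)
flagH-*ˡ (suc n) k F []      = sym (ℤ.*-zeroʳ k)
flagH-*ˡ (suc n) k F (𝐚 ∷ w) = flagH-*ˡ n k (F ∘ (𝐚 ∷_)) w
flagH-*ˡ (suc n) k F (𝐛 ∷ w) =
  trans (cong₂ _-_ (flagH-*ˡ n k (F ∘ (𝐛 ∷_)) w) (flagH-*ˡ n k (F ∘ (𝐚 ∷_)) w)) (distrib k _ _)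
  where
  distrib : ∀ k a b → k * a - k * b ≡ k * (a - b)
  distrib = solve-∀

flagH-sub : ∀ n F G w → flagH n (λ v → F v - G v) w ≡ flagH n F w - flagH n G w
flagH-sub n F G w = begin
  flagH n (λ v → F v - G v) w          ≡⟨ flagH-+ n F (λ v → - G v) w ⟩
  flagH n F w + flagH n (λ v → - G v) w ≡⟨ cong (_+_ (flagH n F w)) (neg w) ⟩
  flagH n F w - flagH n G w            ∎
  where
  neg : ∀ w → flagH n (λ v → - G v) w ≡ - flagH n G w
  neg w = trans (flagH-cong n w (λ v _ → sym (ℤ.-1*i≡-i (G v))))
                (trans (flagH-*ˡ n (- 1ℤ) G w) (ℤ.-1*i≡-i _))

wordPoly : ℕ → (List AB → ℤ) → NCPoly AB
wordPoly n F = map (λ S → (F (uS S) , uS S)) (allSubsets n)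

wordPoly-suc : ∀ n F → wordPoly (suc n) F ≡ 𝐛 ◃ wordPoly n (F ∘ (𝐛 ∷_)) ++ 𝐚 ◃ wordPoly n (F ∘ (𝐚 ∷_))
wordPoly-suc n F = trans (map-++ _ (map (true Vec.∷_) S) (map (false Vec.∷_) S))
                         (cong₂ _++_ (trans (sym (map-∘ S)) (map-∘ S)) (trans (sym (map-∘ S)) (map-∘ S)))
  where
  S = allSubsets n

coeff-σab-wordPoly : ∀ n F w → coeffAB (substₚ σab (wordPoly n F)) w ≡ flagH n F w
coeff-σab-wordPoly zero    F w = coeff-subst-flagH-zero σab F w
coeff-σab-wordPoly (suc n) F w = begin
  coeffAB (substₚ σab (wordPoly (suc n) F)) w
    ≡⟨ cong (λ p → coeffAB (substₚ σab p) w) (wordPoly-suc n F) ⟩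
  coeffAB (substₚ σab (𝐛 ◃ Pb ++ 𝐚 ◃ Pa)) w
    ≡⟨ coeff-subst-++ σab (𝐛 ◃ Pb) (𝐚 ◃ Pa) w ⟩
  coeffAB (substₚ σab (𝐛 ◃ Pb)) w + coeffAB (substₚ σab (𝐚 ◃ Pa)) w
    ≡⟨ cong₂ _+_ (coeff-subst-◃ σab 𝐛 Pb w) (coeff-subst-◃ σab 𝐚 Pa w) ⟩
  coeffAB (σab 𝐛 ·ₚ substₚ σab Pb) w + coeffAB (σab 𝐚 ·ₚ substₚ σab Pa) w
    ≡⟨ cong₂ _+_ (coeff-σab𝐛-· (substₚ σab Pb) w) (coeff-σab𝐚-· (substₚ σab Pa) w) ⟩
  coeffAfter (𝐛 ∷ []) (substₚ σab Pb) w
    + (coeffAfter (𝐚 ∷ []) (substₚ σab Pa) w - coeffAfter (𝐛 ∷ []) (substₚ σab Pa) w)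
    ≡⟨ byFirstLetter w ⟩
  flagH (suc n) F w ∎
  where
  Pa = wordPoly n (F ∘ (𝐚 ∷_))
  Pb = wordPoly n (F ∘ (𝐛 ∷_))
  byFirstLetter : ∀ w → coeffAfter (𝐛 ∷ []) (substₚ σab Pb) w
                          + (coeffAfter (𝐚 ∷ []) (substₚ σab Pa) w - coeffAfter (𝐛 ∷ []) (substₚ σab Pa) w)
                        ≡ flagH (suc n) F w
  byFirstLetter []      = refl
  byFirstLetter (𝐚 ∷ w) = trans (ℤ.+-identityˡ _) (trans (ℤ.+-identityʳ _) (coeff-σab-wordPoly n _ w))
  byFirstLetter (𝐛 ∷ w) = trans (cong (_+_ (coeffAB (substₚ σab Pb) w)) (ℤ.+-identityˡ _))
                                (cong₂ _-_ (coeff-σab-wordPoly n _ w) (coeff-σab-wordPoly n _ w))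

-- Generalized Dehn–Sommerville relations and the cd-index

as : ℕ → List AB
as m = replicate m 𝐚

length-as-++ : ∀ m β → length (as m ++ β) ≡ m ℕ.+ length β
length-as-++ m β = trans (length-++ (as m)) (cong (ℕ._+ length β) (length-replicate m))

-- dsSum F m β = ∑_{i<m} (-1)^i (2 F(a^m β) - F(a^i b a^(m-1-i) β)).  For F a flag
-- f-vector this is ∑_j (-1)^(j-1) f_{S ∪ {j}} - (1 - (-1)^m) f_S, j ranging over a gap of m ranks.
dsSum : (List AB → ℤ) → ℕ → List AB → ℤ
dsSum F zero    β = 0ℤ
dsSum F (suc m) β = + 2 * F (𝐚 ∷ as m ++ β) - F (𝐛 ∷ as m ++ β) - dsSum (F ∘ (𝐚 ∷_)) m β

dsSum-cong : ∀ {F G} m β → (∀ v → F v ≡ G v) → dsSum F m β ≡ dsSum G m β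
dsSum-cong zero    β F≗G = refl
dsSum-cong (suc m) β F≗G =
  cong₂ _-_ (cong₂ _-_ (cong (+ 2 *_) (F≗G _)) (F≗G _)) (dsSum-cong m β (F≗G ∘ (𝐚 ∷_)))

dsSum-+ : ∀ F G m β → dsSum (λ v → F v + G v) m β ≡ dsSum F m β + dsSum G m β
dsSum-+ F G zero    β = refl
dsSum-+ F G (suc m) β =
  trans (cong (_-_ (+ 2 * (F x + G x) - (F y + G y))) (dsSum-+ (F ∘ (𝐚 ∷_)) (G ∘ (𝐚 ∷_)) m β))
        (regroup (F x) (G x) (F y) (G y) (dsSum (F ∘ (𝐚 ∷_)) m β) (dsSum (G ∘ (𝐚 ∷_)) m β))
  where
  x = 𝐚 ∷ as m ++ β
  y = 𝐛 ∷ as m ++ β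
  regroup : ∀ a b c d e f → + 2 * (a + b) - (c + d) - (e + f) ≡ (+ 2 * a - c - e) + (+ 2 * b - d - f)
  regroup = solve-∀

dsSum-*ˡ : ∀ k F m β → dsSum (λ v → k * F v) m β ≡ k * dsSum F m β
dsSum-*ˡ k F zero    β = sym (ℤ.*-zeroʳ k)
dsSum-*ˡ k F (suc m) β =
  trans (cong (_-_ (+ 2 * (k * F x) - k * F y)) (dsSum-*ˡ k (F ∘ (𝐚 ∷_)) m β))
        (distrib k (F x) (F y) (dsSum (F ∘ (𝐚 ∷_)) m β))
  where
  x = 𝐚 ∷ as m ++ β
  y = 𝐛 ∷ as m ++ β
  distrib : ∀ k a b c → + 2 * (k * a) - k * b - k * c ≡ k * (+ 2 * a - b - c)
  distrib = solve-∀

dsSum-sub : ∀ F G m β → dsSum (λ v → F v - G v) m β ≡ dsSum F m β - dsSum G m β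
dsSum-sub F G m β = begin
  dsSum (λ v → F v - G v) m β                  ≡⟨ dsSum-+ F (λ v → - G v) m β ⟩
  dsSum F m β + dsSum (λ v → - G v) m β        ≡⟨ cong (_+_ (dsSum F m β)) neg ⟩
  dsSum F m β - dsSum G m β                    ∎
  where
  neg : dsSum (λ v → - G v) m β ≡ - dsSum G m β
  neg = trans (dsSum-cong m β (λ v → sym (ℤ.-1*i≡-i (G v))))
              (trans (dsSum-*ˡ (- 1ℤ) G m β) (ℤ.-1*i≡-i _))

dsSum-∑ : ∀ {X : Set} (xs : List X) (G : X → List AB → ℤ) m β →
          dsSum (λ v → ∑[ x ← xs ] G x v) m β ≡ ∑[ x ← xs ] dsSum (G x) m β
dsSum-∑ []       G m β = dsSum-0 m
  where
  dsSum-0 : ∀ m → dsSum (λ _ → 0ℤ) m β ≡ 0ℤ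
  dsSum-0 zero    = refl
  dsSum-0 (suc m) = cong (_-_ 0ℤ) (dsSum-0 m)
dsSum-∑ (x ∷ xs) G m β =
  trans (dsSum-+ (G x) (λ v → ∑[ y ← xs ] G y v) m β) (cong (_+_ (dsSum (G x) m β)) (dsSum-∑ xs G m β))

data EndsWith𝐛 : List AB → Set where
  [𝐛] : EndsWith𝐛 (𝐛 ∷ [])
  _∷_ : ∀ x {α} → EndsWith𝐛 α → EndsWith𝐛 (x ∷ α)

-- In α a^m β the block a^m is a gap between consecutive ranks of S ∪ {0, n+1}.
data Flankˡ : List AB → Set where
  []   : Flankˡ []
  end𝐛 : ∀ {α} → EndsWith𝐛 α → Flankˡ α

data Flankʳ : List AB → Set where
  []     : Flankʳ []
  start𝐛 : ∀ β → Flankʳ (𝐛 ∷ β)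

DehnSommerville : ℕ → (List AB → ℤ) → Set
DehnSommerville n F = ∀ α m β → Flankˡ α → Flankʳ β → length α ℕ.+ (m ℕ.+ length β) ≡ n →
                      dsSum (F ∘ (α ++_)) m β ≡ 0ℤ

-- Writing the cd-index as c Φ' + d Φ'', the coefficients of x y w in Φ(a + b, ab + ba)
-- determine the flag h-vectors of Φ' and Φ'' as those of cPart F and dPart F.
dPart : (List AB → ℤ) → List AB → ℤ
dPart F v = F (𝐛 ∷ 𝐚 ∷ v) - + 2 * F (𝐚 ∷ 𝐚 ∷ v)

cPart : (List AB → ℤ) → List AB → ℤ
cPart F (𝐛 ∷ v) = F (𝐚 ∷ 𝐛 ∷ v) - dPart F v
cPart F v       = F (𝐚 ∷ v)

cdIndex : ℕ → (List AB → ℤ) → NCPoly CD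
cdIndex zero          F = (F [] , []) ∷ []
cdIndex (suc zero)    F = 𝐜 ◃ cdIndex zero (cPart F)
cdIndex (suc (suc n)) F = 𝐜 ◃ cdIndex (suc n) (cPart F) ++ 𝐝 ◃ cdIndex n (dPart F)

dehnSommerville-dPart : ∀ n F → DehnSommerville (suc (suc n)) F → DehnSommerville n (dPart F)
dehnSommerville-dPart n F ds α m β fα fβ ∣αβ∣ = begin
  dsSum (dPart F ∘ (α ++_)) m β
    ≡⟨ dsSum-sub (F ∘ ((𝐛 ∷ 𝐚 ∷ α) ++_)) (λ v → + 2 * F (𝐚 ∷ 𝐚 ∷ α ++ v)) m β ⟩
  dsSum (F ∘ ((𝐛 ∷ 𝐚 ∷ α) ++_)) m β - dsSum (λ v → + 2 * F (𝐚 ∷ 𝐚 ∷ α ++ v)) m β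
    ≡⟨ cong (_-_ (dsSum (F ∘ ((𝐛 ∷ 𝐚 ∷ α) ++_)) m β)) (dsSum-*ˡ (+ 2) (F ∘ ((𝐚 ∷ 𝐚 ∷ α) ++_)) m β) ⟩
  dsSum (F ∘ ((𝐛 ∷ 𝐚 ∷ α) ++_)) m β - + 2 * dsSum (F ∘ ((𝐚 ∷ 𝐚 ∷ α) ++_)) m β
    ≡⟨ vanish fα ⟩
  0ℤ ∎
  where
  ∣αβ∣+2 = cong (suc ∘ suc) ∣αβ∣
  vanish : Flankˡ α → dsSum (F ∘ ((𝐛 ∷ 𝐚 ∷ α) ++_)) m β - + 2 * dsSum (F ∘ ((𝐚 ∷ 𝐚 ∷ α) ++_)) m β ≡ 0ℤ
  vanish (end𝐛 e) = cong₂ (λ x y → x - + 2 * y)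
                          (ds (𝐛 ∷ 𝐚 ∷ α) m β (end𝐛 (𝐛 ∷ 𝐚 ∷ e)) fβ ∣αβ∣+2)
                          (ds (𝐚 ∷ 𝐚 ∷ α) m β (end𝐛 (𝐚 ∷ 𝐚 ∷ e)) fβ ∣αβ∣+2)
  -- For α = [] combine three relations of F: on the gaps of b a^(m+1) β, a^(m+2) β and a b a^m β.
  vanish [] = begin
    X₁ - + 2 * X₂                         ≡⟨ combine s t X₁ p q X₂ ⟩
    - r₁ - + 2 * r₂ + r₃                  ≡⟨ cong₂ _+_ (cong₂ (λ x y → - x - + 2 * y) e₁ e₂) e₃ ⟩
    0ℤ                                    ∎
    where
    s = F (𝐛 ∷ 𝐚 ∷ as m ++ β)
    t = F (𝐛 ∷ 𝐛 ∷ as m ++ β)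
    p = F (𝐚 ∷ 𝐚 ∷ as m ++ β)
    q = F (𝐚 ∷ 𝐛 ∷ as m ++ β)
    X₁ = dsSum (F ∘ (𝐛 ∷_) ∘ (𝐚 ∷_)) m β
    X₂ = dsSum (F ∘ (𝐚 ∷_) ∘ (𝐚 ∷_)) m β
    r₁ = + 2 * s - t - X₁
    r₂ = + 2 * p - s - (+ 2 * p - q - X₂)
    r₃ = + 2 * q - t - 0ℤ
    combine : ∀ s t X₁ p q X₂ → X₁ - + 2 * X₂ ≡
              - (+ 2 * s - t - X₁) - + 2 * (+ 2 * p - s - (+ 2 * p - q - X₂)) + (+ 2 * q - t - 0ℤ)
    combine = solve-∀
    e₁ : r₁ ≡ 0ℤ
    e₁ = ds (𝐛 ∷ []) (suc m) β (end𝐛 [𝐛]) fβ ∣αβ∣+2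
    e₂ : r₂ ≡ 0ℤ
    e₂ = ds [] (suc (suc m)) β [] fβ ∣αβ∣+2
    e₃ : r₃ ≡ 0ℤ
    e₃ = ds [] 1 (𝐛 ∷ as m ++ β) [] (start𝐛 _) (cong (suc ∘ suc) (trans (length-as-++ m β) ∣αβ∣))

dehnSommerville-cPart : ∀ n F → DehnSommerville (suc (suc n)) F → DehnSommerville (suc n) (cPart F)
dehnSommerville-cPart n F ds α m β fα fβ ∣αβ∣ = vanish α m fα ∣αβ∣
  where
  vanish : ∀ α m → Flankˡ α → length α ℕ.+ (m ℕ.+ length β) ≡ suc n → dsSum (cPart F ∘ (α ++_)) m β ≡ 0ℤ
  vanish (𝐚 ∷ α) m (end𝐛 (_ ∷ e)) ∣αβ∣ = ds (𝐚 ∷ 𝐚 ∷ α) m β (end𝐛 (𝐚 ∷ 𝐚 ∷ e)) fβ (cong suc ∣αβ∣)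
  vanish (𝐛 ∷ α) m (end𝐛 e)       ∣αβ∣ = begin
    dsSum (cPart F ∘ ((𝐛 ∷ α) ++_)) m β
      ≡⟨ dsSum-sub (F ∘ ((𝐚 ∷ 𝐛 ∷ α) ++_)) (dPart F ∘ (α ++_)) m β ⟩
    dsSum (F ∘ ((𝐚 ∷ 𝐛 ∷ α) ++_)) m β - dsSum (dPart F ∘ (α ++_)) m β
      ≡⟨ cong₂ _-_ (ds (𝐚 ∷ 𝐛 ∷ α) m β (end𝐛 (𝐚 ∷ e)) fβ (cong suc ∣αβ∣))
                   (dehnSommerville-dPart n F ds α m β (flank e) fβ (ℕ.suc-injective ∣αβ∣)) ⟩
    0ℤ ∎
    where
    flank : ∀ {α} → EndsWith𝐛 (𝐛 ∷ α) → Flankˡ α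
    flank [𝐛]     = []
    flank (_ ∷ e) = end𝐛 e
  vanish [] zero     [] _    = refl
  vanish [] (suc m′) [] ∣αβ∣ = begin
    + 2 * p - (q - (s - + 2 * p)) - Z   ≡⟨ combine p q s Z ⟩
    - (+ 2 * p - s - (+ 2 * p - q - Z)) ≡⟨ cong -_ (ds [] (suc (suc m′)) β [] fβ (cong suc ∣αβ∣)) ⟩
    0ℤ                                  ∎
    where
    p = F (𝐚 ∷ 𝐚 ∷ as m′ ++ β)
    q = F (𝐚 ∷ 𝐛 ∷ as m′ ++ β)
    s = F (𝐛 ∷ 𝐚 ∷ as m′ ++ β)
    Z = dsSum (F ∘ (𝐚 ∷_) ∘ (𝐚 ∷_)) m′ β
    combine : ∀ p q s Z → + 2 * p - (q - (s - + 2 * p)) - Z ≡ - (+ 2 * p - s - (+ 2 * p - q - Z))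
    combine = solve-∀
  vanish [] _ (end𝐛 ()) _

flagH-dPart : ∀ n F w →
  flagH n (dPart F) w ≡ flagH n (F ∘ (𝐛 ∷_) ∘ (𝐚 ∷_)) w - + 2 * flagH n (F ∘ (𝐚 ∷_) ∘ (𝐚 ∷_)) w
flagH-dPart n F w =
  trans (flagH-sub n (F ∘ (𝐛 ∷_) ∘ (𝐚 ∷_)) (λ v → + 2 * F (𝐚 ∷ 𝐚 ∷ v)) w)
        (cong (_-_ (flagH n (F ∘ (𝐛 ∷_) ∘ (𝐚 ∷_)) w)) (flagH-*ˡ n (+ 2) (F ∘ (𝐚 ∷_) ∘ (𝐚 ∷_)) w))

flagH-𝐛𝐛 : ∀ n F → DehnSommerville (suc (suc n)) F →
           ∀ w → flagH n (F ∘ (𝐛 ∷_) ∘ (𝐛 ∷_)) w ≡ + 2 * flagH n (F ∘ (𝐚 ∷_) ∘ (𝐛 ∷_)) w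
flagH-𝐛𝐛 n F ds w =
  trans (flagH-cong n w (λ v ∣v∣ → relation v (ds [] 1 (𝐛 ∷ v) [] (start𝐛 v) (cong (suc ∘ suc) ∣v∣))))
        (flagH-*ˡ n (+ 2) (F ∘ (𝐚 ∷_) ∘ (𝐛 ∷_)) w)
  where
  relation : ∀ v → + 2 * F (𝐚 ∷ 𝐛 ∷ v) - F (𝐛 ∷ 𝐛 ∷ v) - 0ℤ ≡ 0ℤ → F (𝐛 ∷ 𝐛 ∷ v) ≡ + 2 * F (𝐚 ∷ 𝐛 ∷ v)
  relation v r = trans (rearrange (F (𝐛 ∷ 𝐛 ∷ v)) (F (𝐚 ∷ 𝐛 ∷ v)))
                       (trans (cong (_-_ (+ 2 * F (𝐚 ∷ 𝐛 ∷ v))) r) (ℤ.+-identityʳ _))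
    where
    rearrange : ∀ b a → b ≡ + 2 * a - (+ 2 * a - b - 0ℤ)
    rearrange = solve-∀

private module TwoLetterPrefixes (n : ℕ) (F : List AB → ℤ) (w : List AB) where
  h𝐚𝐚 h𝐚𝐛 h𝐛𝐚 h𝐝 : ℤ
  h𝐚𝐚 = flagH n (F ∘ (𝐚 ∷_) ∘ (𝐚 ∷_)) w
  h𝐚𝐛 = flagH n (F ∘ (𝐚 ∷_) ∘ (𝐛 ∷_)) w
  h𝐛𝐚 = flagH n (F ∘ (𝐛 ∷_) ∘ (𝐚 ∷_)) w
  h𝐝  = flagH n (dPart F) w

flagH-cPart-dPart : ∀ n F → DehnSommerville (suc (suc n)) F → ∀ x y w →
  flagH (suc n) (cPart F) (y ∷ w) + (if does (x ≟AB y) then 0ℤ else flagH n (dPart F) w)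
    ≡ flagH (suc (suc n)) F (x ∷ y ∷ w)
flagH-cPart-dPart n F ds 𝐚 𝐚 w = ℤ.+-identityʳ _
flagH-cPart-dPart n F ds 𝐚 𝐛 w = begin
  flagH n (cPart F ∘ (𝐛 ∷_)) w - h𝐚𝐚 + h𝐝
    ≡⟨ cong (λ h → h - h𝐚𝐚 + h𝐝) (flagH-sub n (F ∘ (𝐚 ∷_) ∘ (𝐛 ∷_)) (dPart F) w) ⟩
  h𝐚𝐛 - h𝐝 - h𝐚𝐚 + h𝐝
    ≡⟨ cancel h𝐚𝐛 h𝐝 h𝐚𝐚 ⟩
  h𝐚𝐛 - h𝐚𝐚 ∎
  where
  open TwoLetterPrefixes n F w
  cancel : ∀ a r q → a - r - q + r ≡ a - q
  cancel = solve-∀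
flagH-cPart-dPart n F ds 𝐛 𝐚 w = begin
  h𝐚𝐚 + h𝐝                 ≡⟨ cong (_+_ h𝐚𝐚) (flagH-dPart n F w) ⟩
  h𝐚𝐚 + (h𝐛𝐚 - + 2 * h𝐚𝐚)  ≡⟨ rearrange h𝐚𝐚 h𝐛𝐚 ⟩
  h𝐛𝐚 - h𝐚𝐚                ∎
  where
  open TwoLetterPrefixes n F w
  rearrange : ∀ q b → q + (b - + 2 * q) ≡ b - q
  rearrange = solve-∀
flagH-cPart-dPart n F ds 𝐛 𝐛 w = begin
  flagH n (cPart F ∘ (𝐛 ∷_)) w - h𝐚𝐚 + 0ℤ
    ≡⟨ ℤ.+-identityʳ _ ⟩
  flagH n (cPart F ∘ (𝐛 ∷_)) w - h𝐚𝐚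
    ≡⟨ cong (_- h𝐚𝐚) (flagH-sub n (F ∘ (𝐚 ∷_) ∘ (𝐛 ∷_)) (dPart F) w) ⟩
  h𝐚𝐛 - h𝐝 - h𝐚𝐚
    ≡⟨ cong (λ r → h𝐚𝐛 - r - h𝐚𝐚) (flagH-dPart n F w) ⟩
  h𝐚𝐛 - (h𝐛𝐚 - + 2 * h𝐚𝐚) - h𝐚𝐚
    ≡⟨ rearrange h𝐚𝐛 h𝐛𝐚 h𝐚𝐚 ⟩
  + 2 * h𝐚𝐛 - h𝐛𝐚 - (h𝐚𝐛 - h𝐚𝐚)
    ≡⟨ cong (λ b → b - h𝐛𝐚 - (h𝐚𝐛 - h𝐚𝐚)) (sym (flagH-𝐛𝐛 n F ds w)) ⟩
  flagH n (F ∘ (𝐛 ∷_) ∘ (𝐛 ∷_)) w - h𝐛𝐚 - (h𝐚𝐛 - h𝐚𝐚) ∎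
  where
  open TwoLetterPrefixes n F w
  rearrange : ∀ a b q → a - (b - + 2 * q) - q ≡ + 2 * a - b - (a - q)
  rearrange = solve-∀

cdIndex-flagH : ∀ n F → DehnSommerville n F → ∀ w → coeffAB (substₚ σcd (cdIndex n F)) w ≡ flagH n F w
cdIndex-flagH zero          F _  w = coeff-subst-flagH-zero σcd F w
cdIndex-flagH (suc zero)    F ds w = trans (coeff-subst-◃ σcd 𝐜 (cdIndex zero (cPart F)) w) (byLetters w)
  where
  Q = substₚ σcd (cdIndex zero (cPart F))
  byLetters : ∀ w → coeffAB (σcd 𝐜 ·ₚ Q) w ≡ flagH 1 F w
  byLetters []      = coeff-σcd𝐜-· Q []
  byLetters (y ∷ w) =
    trans (coeff-σcd𝐜-∷ Q y w) (trans (coeff-subst-flagH-zero σcd (cPart F) w) (lastLetter y w))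
    where
    lastLetter : ∀ y w → flagH zero (cPart F) w ≡ flagH 1 F (y ∷ w)
    lastLetter 𝐚 []      = refl
    lastLetter 𝐚 (_ ∷ _) = refl
    lastLetter 𝐛 (_ ∷ _) = refl
    lastLetter 𝐛 []      = begin
      F (𝐚 ∷ [])                               ≡⟨ rearrange (F (𝐚 ∷ [])) (F (𝐛 ∷ [])) ⟩
      F (𝐛 ∷ []) - F (𝐚 ∷ []) + dsSum F 1 []   ≡⟨ cong (_+_ (F (𝐛 ∷ []) - F (𝐚 ∷ []))) (ds [] 1 [] [] [] refl) ⟩
      F (𝐛 ∷ []) - F (𝐚 ∷ []) + 0ℤ             ≡⟨ ℤ.+-identityʳ _ ⟩
      F (𝐛 ∷ []) - F (𝐚 ∷ [])                  ∎
      where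
      rearrange : ∀ a b → a ≡ b - a + (+ 2 * a - b - 0ℤ)
      rearrange = solve-∀
cdIndex-flagH (suc (suc n)) F ds w = begin
  coeffAB (substₚ σcd (𝐜 ◃ Φc ++ 𝐝 ◃ Φd)) w
    ≡⟨ coeff-subst-++ σcd (𝐜 ◃ Φc) (𝐝 ◃ Φd) w ⟩
  coeffAB (substₚ σcd (𝐜 ◃ Φc)) w + coeffAB (substₚ σcd (𝐝 ◃ Φd)) w
    ≡⟨ cong₂ _+_ (coeff-subst-◃ σcd 𝐜 Φc w) (coeff-subst-◃ σcd 𝐝 Φd w) ⟩
  coeffAB (σcd 𝐜 ·ₚ Qc) w + coeffAB (σcd 𝐝 ·ₚ Qd) w
    ≡⟨ byLetters w ⟩
  flagH (suc (suc n)) F w ∎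
  where
  Φc = cdIndex (suc n) (cPart F)
  Φd = cdIndex n (dPart F)
  Qc = substₚ σcd Φc
  Qd = substₚ σcd Φd
  IHc : ∀ w → coeffAB Qc w ≡ flagH (suc n) (cPart F) w
  IHc = cdIndex-flagH (suc n) (cPart F) (dehnSommerville-cPart n F ds)
  IHd : ∀ w → coeffAB Qd w ≡ flagH n (dPart F) w
  IHd = cdIndex-flagH n (dPart F) (dehnSommerville-dPart n F ds)
  byLetters : ∀ w → coeffAB (σcd 𝐜 ·ₚ Qc) w + coeffAB (σcd 𝐝 ·ₚ Qd) w ≡ flagH (suc (suc n)) F w
  byLetters []          = cong₂ _+_ (coeff-σcd𝐜-· Qc []) (coeff-σcd𝐝-· Qd [])
  byLetters (𝐚 ∷ [])    = cong₂ _+_ (trans (coeff-σcd𝐜-∷ Qc 𝐚 []) (IHc [])) (coeff-σcd𝐝-· Qd (𝐚 ∷ []))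
  byLetters (𝐛 ∷ [])    = cong₂ _+_ (trans (coeff-σcd𝐜-∷ Qc 𝐛 []) (IHc [])) (coeff-σcd𝐝-· Qd (𝐛 ∷ []))
  byLetters (x ∷ y ∷ w) = begin
    coeffAB (σcd 𝐜 ·ₚ Qc) (x ∷ y ∷ w) + coeffAB (σcd 𝐝 ·ₚ Qd) (x ∷ y ∷ w)
      ≡⟨ cong₂ _+_ (coeff-σcd𝐜-∷ Qc x (y ∷ w)) (coeff-σcd𝐝-∷∷ Qd x y w) ⟩
    coeffAB Qc (y ∷ w) + (if does (x ≟AB y) then 0ℤ else coeffAB Qd w)
      ≡⟨ cong₂ (λ h h′ → h + (if does (x ≟AB y) then 0ℤ else h′)) (IHc (y ∷ w)) (IHd w) ⟩
    flagH (suc n) (cPart F) (y ∷ w) + (if does (x ≟AB y) then 0ℤ else flagH n (dPart F) w)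
      ≡⟨ flagH-cPart-dPart n F ds x y w ⟩
    flagH (suc (suc n)) F (x ∷ y ∷ w) ∎

𝟙 : Bool → ℤ
𝟙 true  = 1ℤ
𝟙 false = 0ℤ

pos-if : ∀ b n → + (if b then n else 0) ≡ 𝟙 b * + n
pos-if true  n = sym (ℤ.*-identityˡ (+ n))
pos-if false n = refl

pos-sumℕ : ∀ {X : Set} (xs : List X) (g : X → ℕ) → + sumℕ (map g xs) ≡ ∑[ x ← xs ] (+ g x)
pos-sumℕ []       g = refl
pos-sumℕ (x ∷ xs) g = trans (ℤ.pos-+ (g x) _) (cong (_+_ (+ g x)) (pos-sumℕ xs g))

sumℤ-map : ∀ {X : Set} (xs : List X) (g : X → ℤ) → sumℤ (map g xs) ≡ ∑ xs g
sumℤ-map []       g = refl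
sumℤ-map (x ∷ xs) g = cong (_+_ (g x)) (sumℤ-map xs g)

pos-length-filter : ∀ {X : Set} (xs : List X) (p : X → Bool) →
                    + length (filter (T? ∘ p) xs) ≡ ∑[ x ← xs ] 𝟙 (p x)
pos-length-filter []       p = refl
pos-length-filter (x ∷ xs) p with p x
... | true  = trans (ℤ.pos-+ 1 _) (cong (_+_ 1ℤ) (pos-length-filter xs p))
... | false = trans (pos-length-filter xs p) (sym (ℤ.+-identityˡ _))

∑-allFin-𝟙-≟ : ∀ n (t : Fin n) (g : Fin n → ℤ) → ∑[ z ← allFin n ] (𝟙 (does (z Fin.≟ t)) * g z) ≡ g t
∑-allFin-𝟙-≟ (suc n) t g =
  trans (cong (_+_ (𝟙 (does (Fin.zero Fin.≟ t)) * g Fin.zero))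
              (∑-allFin-suc n (λ z → 𝟙 (does (z Fin.≟ t)) * g z)))
        (split t)
  where
  split : ∀ t → 𝟙 (does (Fin.zero Fin.≟ t)) * g Fin.zero
                  + ∑[ z ← allFin n ] (𝟙 (does (Fin.suc z Fin.≟ t)) * g (Fin.suc z))
                ≡ g t
  split Fin.zero    = trans (cong (_+_ (1ℤ * g Fin.zero)) (∑-zero (allFin n) (λ _ → refl)))
                            (trans (ℤ.+-identityʳ _) (ℤ.*-identityˡ _))
  split (Fin.suc t) = trans (ℤ.+-identityˡ _) (∑-allFin-𝟙-≟ n t (g ∘ Fin.suc))
  ∑-allFin-suc : ∀ n (h : Fin (suc n) → ℤ) → ∑ (tabulate Fin.suc) h ≡ ∑[ z ← allFin n ] h (Fin.suc z)
  ∑-allFin-suc n h = trans (cong (λ zs → ∑ zs h) (sym (map-tabulate id Fin.suc))) (∑-map Fin.suc (allFin n) h)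

∧-≡true : ∀ {a b} → a ∧ b ≡ true → a ≡ true × b ≡ true
∧-≡true {a} {b} a∧b = ∧-conicalˡ a b a∧b , ∧-conicalʳ a b a∧b

≡true-∧ : ∀ {a b} → a ≡ true → b ≡ true → a ∧ b ≡ true
≡true-∧ refl refl = refl

cong₃ : ∀ {A B C D : Set} (f : A → B → C → D) {a a′ b b′ c c′} → a ≡ a′ → b ≡ b′ → c ≡ c′ → f a b c ≡ f a′ b′ c′
cong₃ f refl refl refl = refl

𝟙-does-* : ∀ {A : Set} (a? : Dec A) x → (A → x ≡ 0ℤ) → 𝟙 (does a?) * x ≡ 0ℤ
𝟙-does-* (yes a) x x≡0 = trans (ℤ.*-identityˡ x) (x≡0 a)
𝟙-does-* (no _)  x _   = refl

𝟙-∧ : ∀ a b x → 𝟙 (a ∧ b) * x ≡ 𝟙 a * (𝟙 b * x)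
𝟙-∧ true  b x = sym (ℤ.*-identityˡ (𝟙 b * x))
𝟙-∧ false b x = refl

count : {X : Set} → (X → Bool) → List X → ℕ
count p []       = 0
count p (x ∷ xs) = if p x then suc (count p xs) else count p xs

module _ {X : Set} {p q : X → Bool} (p⊆q : ∀ w → p w ≡ true → q w ≡ true) where

  count-mono : ∀ xs → count p xs ℕ.≤ count q xs
  count-mono []       = ℕ.z≤n
  count-mono (x ∷ xs) with p x in px | q x in qx
  ... | true  | true  = ℕ.s≤s (count-mono xs)
  ... | true  | false = case (trans (sym (p⊆q x px)) qx) of λ ()
  ... | false | true  = ℕ.m≤n⇒m≤1+n (count-mono xs)
  ... | false | false = count-mono xs

  count-mono-< : ∀ {w xs} → w ∈ xs → q w ≡ true → p w ≡ false → count p xs ℕ.< count q xs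
  count-mono-< {xs = x ∷ xs} (here refl) qw pw rewrite qw | pw = ℕ.s≤s (count-mono xs)
  count-mono-< {xs = x ∷ xs} (there w∈xs) qw pw with p x in px | q x in qx
  ... | true  | true  = ℕ.s≤s (count-mono-< w∈xs qw pw)
  ... | true  | false = case (trans (sym (p⊆q x px)) qx) of λ ()
  ... | false | true  = ℕ.m≤n⇒m≤1+n (count-mono-< w∈xs qw pw)
  ... | false | false = count-mono-< w∈xs qw pw

Elem : GradedPoset → Set
Elem P = Fin (card P)

module _ (P : GradedPoset) where

  le-refl′ : ∀ x → le P x x ≡ true
  le-refl′ x = Equivalence.to T-≡ (le-refl P x)

  le-trans′ : ∀ {x y z} → le P x y ≡ true → le P y z ≡ true → le P x z ≡ true
  le-trans′ {x} {y} {z} x≤y y≤z =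
    Equivalence.to T-≡ (le-trans P x y z (Equivalence.from T-≡ x≤y) (Equivalence.from T-≡ y≤z))

  le-antisym′ : ∀ {x y} → le P x y ≡ true → le P y x ≡ true → x ≡ y
  le-antisym′ {x} {y} x≤y y≤x = le-antisym P x y (Equivalence.from T-≡ x≤y) (Equivalence.from T-≡ y≤x)

  lt-irrefl : ∀ x → lt P x x ≡ false
  lt-irrefl x with x Fin.≟ x
  ... | yes _  = ∧-zeroʳ (le P x x)
  ... | no x≢x = ⊥-elim (x≢x refl)

  lt⇒le : ∀ {x y} → lt P x y ≡ true → le P x y ≡ true
  lt⇒le x<y = proj₁ (∧-≡true x<y)

  lt⇒≢ : ∀ {x y} → lt P x y ≡ true → x ≢ y
  lt⇒≢ {x} x<y refl = case trans (sym x<y) (lt-irrefl x) of λ ()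

  le∧≢⇒lt : ∀ {x y} → le P x y ≡ true → x ≢ y → lt P x y ≡ true
  le∧≢⇒lt {x} {y} x≤y x≢y with x Fin.≟ y
  ... | yes x≡y = ⊥-elim (x≢y x≡y)
  ... | no  _   = trans (∧-identityʳ (le P x y)) x≤y

  lt-trans : ∀ {x y z} → lt P x y ≡ true → lt P y z ≡ true → lt P x z ≡ true
  lt-trans x<y y<z = le∧≢⇒lt (le-trans′ (lt⇒le x<y) (lt⇒le y<z))
                             (λ { refl → lt⇒≢ y<z (le-antisym′ (lt⇒le y<z) (lt⇒le x<y)) })

  lt≡le : ∀ {x y} → x ≢ y → lt P x y ≡ le P x y
  lt≡le {x} {y} x≢y with x Fin.≟ y
  ... | yes x≡y = ⊥-elim (x≢y x≡y)
  ... | no  _   = ∧-identityʳ (le P x y)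

  inInterval : Elem P → Elem P → Elem P → Bool
  inInterval x y z = le P x z ∧ le P z y

  rk-mono : ∀ {x y} → lt P x y ≡ true → rk P x ℕ.< rk P y
  rk-mono {x} {y} = bySize (size x y) ℕ.≤-refl
    where
    size : Elem P → Elem P → ℕ
    size x y = count (inInterval x y) (elems P)
    size-pos : ∀ {x y} → le P x y ≡ true → 0 ℕ.< size x y
    size-pos {x} x≤y = ℕ.≤-<-trans ℕ.z≤n
      (count-mono-< (λ _ ()) (∈-allFin x) (≡true-∧ (le-refl′ x) x≤y) refl)
    shrinkʳ : ∀ {x z y} → le P x z ≡ true → lt P z y ≡ true → size x z ℕ.< size x y
    shrinkʳ {x} {z} {y} x≤z z<y =
      count-mono-< (λ w w∈ → let x≤w , w≤z = ∧-≡true w∈ in ≡true-∧ x≤w (le-trans′ w≤z (lt⇒le z<y)))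
                   (∈-allFin y) (≡true-∧ (le-trans′ x≤z (lt⇒le z<y)) (le-refl′ y))
                   (¬-not λ y∈ → lt⇒≢ z<y (le-antisym′ (lt⇒le z<y) (proj₂ (∧-≡true y∈))))
    shrinkˡ : ∀ {x z y} → lt P x z ≡ true → le P z y ≡ true → size z y ℕ.< size x y
    shrinkˡ {x} {z} {y} x<z z≤y =
      count-mono-< (λ w w∈ → let z≤w , w≤y = ∧-≡true w∈ in ≡true-∧ (le-trans′ (lt⇒le x<z) z≤w) w≤y)
                   (∈-allFin x) (≡true-∧ (le-refl′ x) (le-trans′ (lt⇒le x<z) z≤y))
                   (¬-not λ x∈ → lt⇒≢ x<z (le-antisym′ (lt⇒le x<z) (proj₁ (∧-≡true x∈))))
    bySize : ∀ {x y} s → size x y ℕ.≤ s → lt P x y ≡ true → rk P x ℕ.< rk P y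
    bySize zero    bound x<y = ⊥-elim (ℕ.<-irrefl refl (ℕ.<-≤-trans (size-pos (lt⇒le x<y)) bound))
    bySize {x} {y} (suc s) bound x<y with Fin.any? (λ z → lt P x z ∧ lt P z y Bool.≟ true)
    ... | yes (z , x<z<y) = let x<z , z<y = ∧-≡true x<z<y in
      ℕ.<-trans (bySize s (ℕ.≤-pred (ℕ.<-≤-trans (shrinkʳ (lt⇒le x<z) z<y) bound)) x<z)
                (bySize s (ℕ.≤-pred (ℕ.<-≤-trans (shrinkˡ x<z (lt⇒le z<y)) bound)) z<y)
    ... | no ∄z = ℕ.≤-reflexive (sym (rk-cover P x y (Equivalence.from T-≡ (lt⇒le x<y)) (lt⇒≢ x<y) covers))
      where
      covers : ∀ z → T (le P x z) → x ≢ z → T (le P z y) → z ≢ y → ⊥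
      covers z x≤z x≢z z≤y z≢y = ∄z (z , ≡true-∧ (le∧≢⇒lt (Equivalence.to T-≡ x≤z) x≢z)
                                                  (le∧≢⇒lt (Equivalence.to T-≡ z≤y) z≢y))

  ∑open : Elem P → Elem P → (Elem P → ℤ) → ℤ
  ∑open x y g = ∑[ z ← elems P ] (𝟙 (lt P x z) * (𝟙 (lt P z y) * g z))

  sgn : Elem P → ℤ
  sgn z = negOnePow (rk P z)

-- Euler relations of intervals

negOnePow-evenB : ∀ r → negOnePow r ≡ (if evenB r then 1ℤ else - 1ℤ)
negOnePow-evenB zero    = refl
negOnePow-evenB (suc r) with evenB r | negOnePow-evenB r
... | true  | e = cong -_ e
... | false | e = cong -_ e

negOnePow-even : ∀ r → evenB r ≡ true → negOnePow r ≡ 1ℤ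
negOnePow-even r r-even = trans (negOnePow-evenB r) (cong (if_then 1ℤ else - 1ℤ) r-even)

negOnePow-odd : ∀ r → evenB r ≡ false → negOnePow r ≡ - 1ℤ
negOnePow-odd r r-odd = trans (negOnePow-evenB r) (cong (if_then 1ℤ else - 1ℤ) r-odd)

negOnePow-square : ∀ k → negOnePow k * negOnePow k ≡ 1ℤ
negOnePow-square zero    = refl
negOnePow-square (suc k) = trans (neg-square (negOnePow k)) (negOnePow-square k)
  where
  neg-square : ∀ s → - s * - s ≡ s * s
  neg-square = solve-∀

module _ (P : GradedPoset) where

  𝟙-interval : ∀ {s t} → lt P s t ≡ true → ∀ (g : Elem P → ℤ) z →
    𝟙 (inInterval P s t z) * g z ≡
    𝟙 (does (z Fin.≟ s)) * g z + (𝟙 (does (z Fin.≟ t)) * g z + 𝟙 (lt P s z) * (𝟙 (lt P z t) * g z))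
  𝟙-interval {s} {t} s<t g z with z Fin.≟ s
  ... | yes refl = begin
    𝟙 (le P s s ∧ le P s t) * g s  ≡⟨ cong (λ b → 𝟙 b * g s) (≡true-∧ (le-refl′ P s) (lt⇒le P s<t)) ⟩
    1ℤ * g s                       ≡⟨ sym (ℤ.+-identityʳ _) ⟩
    1ℤ * g s + 0ℤ                  ≡⟨ cong₂ (λ b c → 1ℤ * g s + (𝟙 b * g s + 𝟙 c * (𝟙 (lt P s t) * g s)))
                                            (sym (dec-false (s Fin.≟ t) (lt⇒≢ P s<t))) (sym (lt-irrefl P s)) ⟩
    1ℤ * g s + (𝟙 (does (s Fin.≟ t)) * g s + 𝟙 (lt P s s) * (𝟙 (lt P s t) * g s)) ∎
  ... | no z≢s = case z Fin.≟ t of λ where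
    (yes refl) → begin
      𝟙 (le P s t ∧ le P t t) * g t  ≡⟨ cong (λ b → 𝟙 b * g t) (≡true-∧ (lt⇒le P s<t) (le-refl′ P t)) ⟩
      1ℤ * g t                       ≡⟨ sym (trans (ℤ.+-identityˡ _) (ℤ.+-identityʳ _)) ⟩
      0ℤ + (1ℤ * g t + 0ℤ)           ≡⟨ cong₃ (λ a b c → 0ℤ + (𝟙 a * g t + 𝟙 b * (𝟙 c * g t)))
                                              (sym (dec-true (t Fin.≟ t) refl)) (sym s<t) (sym (lt-irrefl P t)) ⟩
      0ℤ + (𝟙 (does (t Fin.≟ t)) * g t + 𝟙 (lt P s t) * (𝟙 (lt P t t) * g t)) ∎
    (no z≢t) → begin
      𝟙 (le P s z ∧ le P z t) * g z             ≡⟨ 𝟙-∧ (le P s z) (le P z t) (g z) ⟩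
      𝟙 (le P s z) * (𝟙 (le P z t) * g z)       ≡⟨ cong₂ (λ b c → 𝟙 b * (𝟙 c * g z))
                                                         (sym (lt≡le P (z≢s ∘ sym))) (sym (lt≡le P z≢t)) ⟩
      𝟙 (lt P s z) * (𝟙 (lt P z t) * g z)       ≡⟨ sym (trans (ℤ.+-identityˡ _) (ℤ.+-identityˡ _)) ⟩
      0ℤ + (0ℤ + 𝟙 (lt P s z) * (𝟙 (lt P z t) * g z))
        ≡⟨ cong (λ b → 0ℤ + (𝟙 b * g z + 𝟙 (lt P s z) * (𝟙 (lt P z t) * g z)))
                (sym (dec-false (z Fin.≟ t) z≢t)) ⟩
      0ℤ + (𝟙 (does (z Fin.≟ t)) * g z + 𝟙 (lt P s z) * (𝟙 (lt P z t) * g z)) ∎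

  euler-closed : SemiEulerian P → ∀ {s t} → lt P s t ≡ true → ¬ (s ≡ bot P × t ≡ top P) →
                 ∑[ z ← elems P ] (𝟙 (inInterval P s t z) * sgn P z) ≡ 0ℤ
  euler-closed se {s} {t} s<t not-full = begin
    ∑[ z ← elems P ] (𝟙 (inInterval P s t z) * sgn P z)
      ≡⟨ ∑-cong (elems P) (λ z → byParity (le P s z) (le P z t) (rk P z)) ⟩
    ∑[ z ← elems P ] (𝟙 (inEven z) - 𝟙 (inOdd z))
      ≡⟨ ∑-sub (elems P) (𝟙 ∘ inEven) (𝟙 ∘ inOdd) ⟩
    ∑ (elems P) (𝟙 ∘ inEven) - ∑ (elems P) (𝟙 ∘ inOdd)
      ≡⟨ sym (cong₂ _-_ (pos-length-filter (elems P) inEven) (pos-length-filter (elems P) inOdd)) ⟩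
    + nEvenIn P s t - + nOddIn P s t
      ≡⟨ cong (λ k → + k - + nOddIn P s t) (se s t (Equivalence.from T-≡ (lt⇒le P s<t)) (lt⇒≢ P s<t) not-full) ⟩
    + nOddIn P s t - + nOddIn P s t
      ≡⟨ ℤ.+-inverseʳ (+ nOddIn P s t) ⟩
    0ℤ ∎
    where
    inEven inOdd : Elem P → Bool
    inEven z = le P s z ∧ le P z t ∧ evenB (rk P z)
    inOdd  z = le P s z ∧ le P z t ∧ not (evenB (rk P z))
    byParity : ∀ a b r → 𝟙 (a ∧ b) * negOnePow r ≡ 𝟙 (a ∧ b ∧ evenB r) - 𝟙 (a ∧ b ∧ not (evenB r))
    byParity a b r rewrite negOnePow-evenB r with a | b | evenB r
    ... | true  | true  | true  = refl
    ... | true  | true  | false = refl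
    ... | true  | false | _     = refl
    ... | false | _     | _     = refl

  euler-open : SemiEulerian P → ∀ {s t} → lt P s t ≡ true → ¬ (s ≡ bot P × t ≡ top P) →
               sgn P s + (sgn P t + ∑open P s t (sgn P)) ≡ 0ℤ
  euler-open se {s} {t} s<t not-full = begin
    sgn P s + (sgn P t + ∑open P s t (sgn P))
      ≡⟨ sym (cong₂ _+_ (∑-allFin-𝟙-≟ (card P) s (sgn P))
                        (cong (_+ ∑open P s t (sgn P)) (∑-allFin-𝟙-≟ (card P) t (sgn P)))) ⟩
    ∑ (elems P) (δ s) + (∑ (elems P) (δ t) + ∑ (elems P) inner)
      ≡⟨ sym (trans (∑-+ (elems P) (δ s) (λ z → δ t z + inner z))
                    (cong (_+_ (∑ (elems P) (δ s))) (∑-+ (elems P) (δ t) inner))) ⟩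
    ∑[ z ← elems P ] (δ s z + (δ t z + inner z))
      ≡⟨ sym (∑-cong (elems P) (𝟙-interval s<t (sgn P))) ⟩
    ∑[ z ← elems P ] (𝟙 (inInterval P s t z) * sgn P z)
      ≡⟨ euler-closed se s<t not-full ⟩
    0ℤ ∎
    where
    δ : Elem P → Elem P → ℤ
    δ x z = 𝟙 (does (z Fin.≟ x)) * sgn P z
    inner : Elem P → ℤ
    inner z = 𝟙 (lt P s z) * (𝟙 (lt P z t) * sgn P z)

  ∑open-linear : ∀ x y f c g → ∑open P x y (λ z → f z + c * g z) ≡ ∑open P x y f + c * ∑open P x y g
  ∑open-linear x y f c g = begin
    ∑open P x y (λ z → f z + c * g z)
      ≡⟨ ∑-cong (elems P) (λ z → distrib (𝟙 (lt P x z)) (𝟙 (lt P z y)) (f z) c (g z)) ⟩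
    ∑[ z ← elems P ] (𝟙 (lt P x z) * (𝟙 (lt P z y) * f z) + c * (𝟙 (lt P x z) * (𝟙 (lt P z y) * g z)))
      ≡⟨ ∑-+ (elems P) (λ z → 𝟙 (lt P x z) * (𝟙 (lt P z y) * f z)) _ ⟩
    ∑open P x y f + ∑[ z ← elems P ] (c * (𝟙 (lt P x z) * (𝟙 (lt P z y) * g z)))
      ≡⟨ cong (_+_ (∑open P x y f)) (∑-*ˡ (elems P) c (λ z → 𝟙 (lt P x z) * (𝟙 (lt P z y) * g z))) ⟩
    ∑open P x y f + c * ∑open P x y g ∎
    where
    distrib : ∀ a b f c g → a * (b * (f + c * g)) ≡ a * (b * f) + c * (a * (b * g))
    distrib = solve-∀

  rankCount : Elem P → ℕ → Elem P → ℤ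
  rankCount x j y = ∑open P x y (λ z → 𝟙 (does (rk P z ℕ.≟ j)))

  signSumAbove : Elem P → Elem P → ℕ → ℤ
  signSumAbove x y k = ∑open P x y (λ z → 𝟙 (does (k ℕ.<? rk P z)) * sgn P z)

  -- The dsSum of the chain counts of the open interval (x, y), with x placed at rank k.
  gapSum : Elem P → ℕ → ℕ → Elem P → ℤ
  gapSum x k zero    y = 0ℤ
  gapSum x k (suc m) y = + 2 - rankCount x (suc k) y - gapSum x (suc k) m y

  signSumAbove-suc : ∀ x y k →
    signSumAbove x y k ≡ signSumAbove x y (suc k) + negOnePow (suc k) * rankCount x (suc k) y
  signSumAbove-suc x y k =
    trans (∑-cong (elems P) (λ z → cong (λ u → 𝟙 (lt P x z) * (𝟙 (lt P z y) * u)) (peel (rk P z))))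
          (∑open-linear x y (λ z → 𝟙 (does (suc k ℕ.<? rk P z)) * sgn P z) (negOnePow (suc k))
                        (λ z → 𝟙 (does (rk P z ℕ.≟ suc k))))
    where
    byIndicators : ∀ r {a b c} → does (k ℕ.<? r) ≡ a → does (suc k ℕ.<? r) ≡ b → does (r ℕ.≟ suc k) ≡ c →
                   𝟙 a * negOnePow r ≡ 𝟙 b * negOnePow r + negOnePow (suc k) * 𝟙 c →
                   𝟙 (does (k ℕ.<? r)) * negOnePow r
                     ≡ 𝟙 (does (suc k ℕ.<? r)) * negOnePow r + negOnePow (suc k) * 𝟙 (does (r ℕ.≟ suc k))
    byIndicators r refl refl refl eq = eq
    peel : ∀ r → 𝟙 (does (k ℕ.<? r)) * negOnePow r
               ≡ 𝟙 (does (suc k ℕ.<? r)) * negOnePow r + negOnePow (suc k) * 𝟙 (does (r ℕ.≟ suc k))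
    peel r with ℕ.<-cmp (suc k) r
    ... | tri< k+1<r k+1≢r _ =
      byIndicators r (dec-true (k ℕ.<? r) (ℕ.<-trans (ℕ.n<1+n k) k+1<r)) (dec-true (suc k ℕ.<? r) k+1<r)
                   (dec-false (r ℕ.≟ suc k) (k+1≢r ∘ sym)) (above (negOnePow r) (negOnePow (suc k)))
      where
      above : ∀ s t → 1ℤ * s ≡ 1ℤ * s + t * 0ℤ
      above = solve-∀
    ... | tri≈ _ refl _ =
      byIndicators (suc k) (dec-true (k ℕ.<? suc k) (ℕ.n<1+n k))
                   (dec-false (suc k ℕ.<? suc k) (ℕ.<-irrefl refl))
                   (dec-true (suc k ℕ.≟ suc k) refl) (at (negOnePow (suc k)))
      where
      at : ∀ s → 1ℤ * s ≡ 0ℤ * s + s * 1ℤ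
      at = solve-∀
    ... | tri> _ _ r<k+1 =
      byIndicators r (dec-false (k ℕ.<? r) (ℕ.≤⇒≯ (ℕ.≤-pred r<k+1))) (dec-false (suc k ℕ.<? r) (ℕ.<-asym r<k+1))
                   (dec-false (r ℕ.≟ suc k) (ℕ.<⇒≢ r<k+1)) (below (negOnePow r) (negOnePow (suc k)))
      where
      below : ∀ s t → 0ℤ * s ≡ 0ℤ * s + t * 0ℤ
      below = solve-∀

  signSumAbove-rk : ∀ x y → signSumAbove x y (rk P x) ≡ ∑open P x y (sgn P)
  signSumAbove-rk x y = ∑-cong (elems P) above-x
    where
    above-x : ∀ z → 𝟙 (lt P x z) * (𝟙 (lt P z y) * (𝟙 (does (rk P x ℕ.<? rk P z)) * sgn P z))
                  ≡ 𝟙 (lt P x z) * (𝟙 (lt P z y) * sgn P z)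
    above-x z with lt P x z in x<z
    ... | false = refl
    ... | true  = trans (cong (λ b → 1ℤ * (𝟙 (lt P z y) * (𝟙 b * sgn P z)))
                              (dec-true (rk P x ℕ.<? rk P z) (rk-mono P x<z)))
                        (cong (λ u → 1ℤ * (𝟙 (lt P z y) * u)) (ℤ.*-identityˡ (sgn P z)))

  signSumAbove-below-rk : ∀ x y k → rk P y ≡ suc k → signSumAbove x y k ≡ 0ℤ
  signSumAbove-below-rk x y k ry = ∑-zero (elems P) below-y
    where
    below-y : ∀ z → 𝟙 (lt P x z) * (𝟙 (lt P z y) * (𝟙 (does (k ℕ.<? rk P z)) * sgn P z)) ≡ 0ℤ
    below-y z with lt P z y in z<y
    ... | false = ℤ.*-zeroʳ (𝟙 (lt P x z))
    ... | true  = trans (cong (λ b → 𝟙 (lt P x z) * (1ℤ * (𝟙 b * sgn P z))) (dec-false (k ℕ.<? rk P z) k≮rk))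
                        (ℤ.*-zeroʳ (𝟙 (lt P x z)))
      where
      k≮rk : ¬ (k ℕ.< rk P z)
      k≮rk = ℕ.≤⇒≯ (ℕ.≤-pred (subst (rk P z ℕ.<_) ry (rk-mono P z<y)))

  gapSum-signSum : ∀ x y m k → rk P y ≡ suc (m ℕ.+ k) →
                   negOnePow k * gapSum x k m y ≡ negOnePow k + (sgn P y + signSumAbove x y k)
  gapSum-signSum x y zero k ry = begin
    negOnePow k * 0ℤ                    ≡⟨ cancel (negOnePow k) ⟩
    negOnePow k + (- negOnePow k + 0ℤ)  ≡⟨ sym (cong₂ (λ a b → negOnePow k + (a + b)) (cong negOnePow ry)
                                                      (signSumAbove-below-rk x y k ry)) ⟩
    negOnePow k + (sgn P y + signSumAbove x y k) ∎
    where
    cancel : ∀ s → s * 0ℤ ≡ s + (- s + 0ℤ)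
    cancel = solve-∀
  gapSum-signSum x y (suc m) k ry = begin
    s * (+ 2 - N - E)                        ≡⟨ expand s N E ⟩
    + 2 * s - s * N + - s * E                ≡⟨ cong (_+_ (+ 2 * s - s * N)) IH ⟩
    + 2 * s - s * N + (- s + (sgn P y + O))  ≡⟨ regroup s N (sgn P y) O ⟩
    s + (sgn P y + (O + - s * N))            ≡⟨ cong (λ u → s + (sgn P y + u)) (sym (signSumAbove-suc x y k)) ⟩
    s + (sgn P y + signSumAbove x y k)       ∎
    where
    s = negOnePow k
    N = rankCount x (suc k) y
    E = gapSum x (suc k) m y
    O = signSumAbove x y (suc k)
    IH : - s * E ≡ - s + (sgn P y + O)
    IH = gapSum-signSum x y m (suc k) (trans ry (cong suc (sym (ℕ.+-suc m k))))
    expand : ∀ s n e → s * (+ 2 - n - e) ≡ + 2 * s - s * n + - s * e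
    expand = solve-∀
    regroup : ∀ s n r o → + 2 * s - s * n + (- s + (r + o)) ≡ s + (r + (o + - s * n))
    regroup = solve-∀

  signSumAbove-telescope : ∀ x y m →
    signSumAbove x y 0 ≡ signSumAbove x y m - ∑[ j ← upTo m ] (negOnePow j * rankCount x (suc j) y)
  signSumAbove-telescope x y zero    = sym (ℤ.+-identityʳ _)
  signSumAbove-telescope x y (suc m) = begin
    signSumAbove x y 0                                   ≡⟨ signSumAbove-telescope x y m ⟩
    O m - S                                              ≡⟨ cong (_- S) (signSumAbove-suc x y m) ⟩
    O (suc m) + - negOnePow m * rankCount x (suc m) y - S
      ≡⟨ regroup (O (suc m)) (negOnePow m) (rankCount x (suc m) y) S ⟩
    O (suc m) - (S + (negOnePow m * rankCount x (suc m) y + 0ℤ))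
      ≡⟨ cong (_-_ (O (suc m))) (sym (trans (cong (λ js → ∑ js f) (sym (upTo-∷ʳ m)))
                                            (∑-++ (upTo m) (m ∷ []) f))) ⟩
    O (suc m) - ∑ (upTo (suc m)) f                       ∎
    where
    O = signSumAbove x y
    f : ℕ → ℤ
    f j = negOnePow j * rankCount x (suc j) y
    S = ∑ (upTo m) f
    regroup : ∀ o s r t → o + - s * r - t ≡ o - (t + (s * r + 0ℤ))
    regroup = solve-∀

  gapSum-vanish : SemiEulerian P → ∀ {x y} m → lt P x y ≡ true → rk P y ≡ suc (m ℕ.+ rk P x) →
                  ¬ (x ≡ bot P × y ≡ top P) → gapSum x (rk P x) m y ≡ 0ℤ
  gapSum-vanish se {x} {y} m x<y ry not-full = begin
    E                  ≡⟨ sym (ℤ.*-identityˡ E) ⟩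
    1ℤ * E             ≡⟨ cong (_* E) (sym (negOnePow-square (rk P x))) ⟩
    sgn P x * sgn P x * E ≡⟨ ℤ.*-assoc (sgn P x) (sgn P x) E ⟩
    sgn P x * (sgn P x * E) ≡⟨ cong (sgn P x *_) signed ⟩
    sgn P x * 0ℤ       ≡⟨ ℤ.*-zeroʳ (sgn P x) ⟩
    0ℤ                 ∎
    where
    E = gapSum x (rk P x) m y
    signed : sgn P x * E ≡ 0ℤ
    signed = trans (gapSum-signSum x y m (rk P x) ry)
                   (trans (cong (λ o → sgn P x + (sgn P y + o)) (signSumAbove-rk x y))
                          (euler-open se x<y not-full))

  ∑open-vanish : ∀ {x y} g → lt P x y ≡ false → ∑open P x y g ≡ 0ℤ
  ∑open-vanish {x} {y} g x≮y = ∑-zero (elems P) outside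
    where
    outside : ∀ z → 𝟙 (lt P x z) * (𝟙 (lt P z y) * g z) ≡ 0ℤ
    outside z with lt P x z in x<z | lt P z y in z<y
    ... | true  | true  = case trans (sym (lt-trans P x<z z<y)) x≮y of λ ()
    ... | true  | false = refl
    ... | false | _     = refl

  ∑open-𝟙 : ∀ x y g → ∑open P x y g ≡ 𝟙 (lt P x y) * ∑open P x y g
  ∑open-𝟙 x y g with lt P x y in x<y
  ... | true  = sym (ℤ.*-identityˡ _)
  ... | false = ∑open-vanish g x<y

  ∑-swap-chain : ∀ x (g h : Elem P → ℤ) →
              ∑[ z ← elems P ] (𝟙 (lt P x z) * (g z * ∑[ y ← elems P ] (𝟙 (lt P z y) * h y)))
              ≡ ∑[ y ← elems P ] (𝟙 (lt P x y) * (h y * ∑open P x y g))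
  ∑-swap-chain x g h = begin
    ∑[ z ← E ] (𝟙 (lt P x z) * (g z * ∑[ y ← E ] (𝟙 (lt P z y) * h y)))
      ≡⟨ ∑-cong E (λ z → sym (trans (∑-*ˡ E (𝟙 (lt P x z)) _) (cong (𝟙 (lt P x z) *_) (∑-*ˡ E (g z) _)))) ⟩
    ∑[ z ← E ] ∑[ y ← E ] (𝟙 (lt P x z) * (g z * (𝟙 (lt P z y) * h y)))
      ≡⟨ ∑-swap E E (λ z y → 𝟙 (lt P x z) * (g z * (𝟙 (lt P z y) * h y))) ⟩
    ∑[ y ← E ] ∑[ z ← E ] (𝟙 (lt P x z) * (g z * (𝟙 (lt P z y) * h y)))
      ≡⟨ ∑-cong E (λ y → trans (∑-cong E (λ z → reorder (𝟙 (lt P x z)) (g z) (𝟙 (lt P z y)) (h y)))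
                               (∑-*ʳ E (h y) (λ z → 𝟙 (lt P x z) * (𝟙 (lt P z y) * g z)))) ⟩
    ∑[ y ← E ] (∑open P x y g * h y)
      ≡⟨ ∑-cong E (λ y → trans (cong (_* h y) (∑open-𝟙 x y g)) (regroup (𝟙 (lt P x y)) (∑open P x y g) (h y))) ⟩
    ∑[ y ← E ] (𝟙 (lt P x y) * (h y * ∑open P x y g)) ∎
    where
    E = elems P
    reorder : ∀ a g b h → a * (g * (b * h)) ≡ a * (b * g) * h
    reorder = solve-∀
    regroup : ∀ a o h → a * o * h ≡ a * (h * o)
    regroup = solve-∀

  -- flagChains x k w counts the chains x < y₁ < ... < yᵣ < 1̂ in which the rank of yᵢ is k plus the
  -- position of the i-th letter 𝐛 of w.
  flagChains : Elem P → ℕ → List AB → ℕ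
  flagChains x k []      = if lt P x (top P) then 1 else 0
  flagChains x k (𝐚 ∷ w) = flagChains x (suc k) w
  flagChains x k (𝐛 ∷ w) =
    sumℕ (map (λ y → if lt P x y ∧ does (rk P y ℕ.≟ suc k) then flagChains y (suc k) w else 0) (elems P))

  chainsFrom-ranksFrom : ∀ {m} x k (S : Vec Bool m) → chainsFrom P x (ranksFrom k S) ≡ flagChains x k (uS S)
  chainsFrom-ranksFrom x k []           = refl
  chainsFrom-ranksFrom x k (true ∷ S)  =
    cong sumℕ (map-cong (λ y → cong (if lt P x y ∧ does (rk P y ℕ.≟ suc k) then_else 0)
                                    (chainsFrom-ranksFrom y (suc k) S)) (elems P))
  chainsFrom-ranksFrom x k (false ∷ S) = chainsFrom-ranksFrom x (suc k) S

  flagChains-as : ∀ x k j w → flagChains x k (as j ++ w) ≡ flagChains x (j ℕ.+ k) w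
  flagChains-as x k zero    w = refl
  flagChains-as x k (suc j) w =
    trans (flagChains-as x (suc k) j w) (cong (λ K → flagChains x K w) (ℕ.+-suc j k))

  flagChains-𝐛 : ∀ x k w → + flagChains x k (𝐛 ∷ w)
                           ≡ ∑[ y ← elems P ]
                               (𝟙 (lt P x y) * (𝟙 (does (rk P y ℕ.≟ suc k)) * + flagChains y (suc k) w))
  flagChains-𝐛 x k w = trans (pos-sumℕ (elems P) _) (∑-cong (elems P) (λ y → pos-if-∧ (lt P x y) _ _))
    where
    pos-if-∧ : ∀ a b n → + (if a ∧ b then n else 0) ≡ 𝟙 a * (𝟙 b * + n)
    pos-if-∧ true  b n = trans (pos-if b n) (sym (ℤ.*-identityˡ _))
    pos-if-∧ false b n = refl

  -- The chains above x along a^j β are counted through the element y at which they leave the block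
  -- of a's, with weight ω (j + k) y.
  FactorsThrough : List AB → (ℕ → Elem P → ℤ) → Set
  FactorsThrough β ω = ∀ x k j → + flagChains x k (as j ++ β) ≡ ∑[ y ← elems P ] (𝟙 (lt P x y) * ω (j ℕ.+ k) y)

  flagChains-𝐛-as : ∀ β ω → FactorsThrough β ω → ∀ x k m →
    + flagChains x k (𝐛 ∷ as m ++ β)
      ≡ ∑[ y ← elems P ] (𝟙 (lt P x y) * (ω (suc m ℕ.+ k) y * rankCount x (suc k) y))
  flagChains-𝐛-as β ω factor x k m = begin
    + flagChains x k (𝐛 ∷ as m ++ β)
      ≡⟨ flagChains-𝐛 x k (as m ++ β) ⟩
    ∑[ z ← E ] (𝟙 (lt P x z) * (𝟙 (does (rk P z ℕ.≟ suc k)) * + flagChains z (suc k) (as m ++ β)))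
      ≡⟨ ∑-cong E (λ z → cong (λ u → 𝟙 (lt P x z) * (𝟙 (does (rk P z ℕ.≟ suc k)) * u)) (factor z (suc k) m)) ⟩
    ∑[ z ← E ] (𝟙 (lt P x z) * (𝟙 (does (rk P z ℕ.≟ suc k)) * ∑[ y ← E ] (𝟙 (lt P z y) * ω (m ℕ.+ suc k) y)))
      ≡⟨ ∑-swap-chain x (λ z → 𝟙 (does (rk P z ℕ.≟ suc k))) (ω (m ℕ.+ suc k)) ⟩
    ∑[ y ← E ] (𝟙 (lt P x y) * (ω (m ℕ.+ suc k) y * rankCount x (suc k) y))
      ≡⟨ cong (λ K → ∑[ y ← E ] (𝟙 (lt P x y) * (ω K y * rankCount x (suc k) y))) (ℕ.+-suc m k) ⟩
    ∑[ y ← E ] (𝟙 (lt P x y) * (ω (suc m ℕ.+ k) y * rankCount x (suc k) y)) ∎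
    where
    E = elems P

  dsSum-flagChains : ∀ β ω → FactorsThrough β ω → ∀ x m k →
    dsSum (λ v → + flagChains x k v) m β ≡ ∑[ y ← elems P ] (𝟙 (lt P x y) * (ω (m ℕ.+ k) y * gapSum x k m y))
  dsSum-flagChains β ω factor x zero k =
    sym (∑-zero (elems P) (λ y → trans (cong (𝟙 (lt P x y) *_) (ℤ.*-zeroʳ (ω k y))) (ℤ.*-zeroʳ (𝟙 (lt P x y)))))
  dsSum-flagChains β ω factor x (suc m) k = begin
    + 2 * + flagChains x k (as (suc m) ++ β) - + flagChains x k (𝐛 ∷ as m ++ β)
      - dsSum (λ v → + flagChains x (suc k) v) m β
      ≡⟨ cong₃ (λ a b c → + 2 * a - b - c) (factor x k (suc m)) (flagChains-𝐛-as β ω factor x k m)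
               (trans (dsSum-flagChains β ω factor x m (suc k))
                      (cong (λ K → ∑[ y ← E ] (𝟙 (lt P x y) * (ω K y * gapSum x (suc k) m y))) (ℕ.+-suc m k))) ⟩
    + 2 * ∑ E A - ∑ E B - ∑ E C
      ≡⟨ sym (trans (∑-sub E (λ y → + 2 * A y - B y) C)
                    (cong (_- ∑ E C) (trans (∑-sub E (λ y → + 2 * A y) B) (cong (_- ∑ E B) (∑-*ˡ E (+ 2) A))))) ⟩
    ∑[ y ← E ] (+ 2 * A y - B y - C y)
      ≡⟨ ∑-cong E (λ y → collect (𝟙 (lt P x y)) (ω K y) (rankCount x (suc k) y) (gapSum x (suc k) m y)) ⟩
    ∑[ y ← E ] (𝟙 (lt P x y) * (ω K y * gapSum x k (suc m) y)) ∎
    where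
    E = elems P
    K = suc m ℕ.+ k
    A B C : Elem P → ℤ
    A y = 𝟙 (lt P x y) * ω K y
    B y = 𝟙 (lt P x y) * (ω K y * rankCount x (suc k) y)
    C y = 𝟙 (lt P x y) * (ω K y * gapSum x (suc k) m y)
    collect : ∀ a w n e → + 2 * (a * w) - a * (w * n) - a * (w * e) ≡ a * (w * (+ 2 - n - e))
    collect = solve-∀

-- The modified flag f-vector of a semi-Eulerian poset

-- For |u| = n, isAⁿ𝐛 u holds exactly for u = a^(n-1) b, the word of S = {n}.
isAⁿ𝐛 : List AB → Bool
isAⁿ𝐛 []      = false
isAⁿ𝐛 (𝐚 ∷ u) = isAⁿ𝐛 u
isAⁿ𝐛 (𝐛 ∷ u) = null u

isAⁿ𝐛-as : ∀ j u → isAⁿ𝐛 (as j ++ u) ≡ isAⁿ𝐛 u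
isAⁿ𝐛-as zero    u = refl
isAⁿ𝐛-as (suc j) u = isAⁿ𝐛-as j u

null-++-∷ : ∀ (u : List AB) x v → null (u ++ x ∷ v) ≡ false
null-++-∷ []      x v = refl
null-++-∷ (_ ∷ _) x v = refl

isAⁿ𝐛-after : ∀ {α} → EndsWith𝐛 α → ∀ x v → isAⁿ𝐛 (α ++ x ∷ v) ≡ false
isAⁿ𝐛-after [𝐛]                 x v = refl
isAⁿ𝐛-after (𝐚 ∷ e)             x v = isAⁿ𝐛-after e x v
isAⁿ𝐛-after {𝐛 ∷ α} (_ ∷ _)     x v = null-++-∷ α x v

ranksFrom-isAⁿ𝐛 : ∀ {m} k (S : Vec Bool m) → ranksFrom k S ≡ (k ℕ.+ m) ∷ [] → isAⁿ𝐛 (uS S) ≡ true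
ranksFrom-isAⁿ𝐛 k (true ∷ [])         _  = refl
ranksFrom-isAⁿ𝐛 {suc (suc m)} k (true ∷ _ ∷ _) eq =
  ⊥-elim (ℕ.m+1+n≢m k (sym (ℕ.suc-injective (trans (proj₁ (∷-injective eq)) (ℕ.+-suc k (suc m))))))
ranksFrom-isAⁿ𝐛 {suc m} k (false ∷ S)  eq = ranksFrom-isAⁿ𝐛 (suc k) S (trans eq (cong (_∷ []) (ℕ.+-suc k m)))

isAⁿ𝐛-ranksFrom : ∀ {m} k (S : Vec Bool m) → isAⁿ𝐛 (uS S) ≡ true → ranksFrom k S ≡ (k ℕ.+ m) ∷ []
isAⁿ𝐛-ranksFrom k (true ∷ [])        _  = cong (_∷ []) (ℕ.+-comm 1 k)
isAⁿ𝐛-ranksFrom {suc m} k (false ∷ S) eq =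
  trans (isAⁿ𝐛-ranksFrom (suc k) S eq) (cong (_∷ []) (sym (ℕ.+-suc k m)))

dsSum-∷-zero : ∀ F m β → (∀ x v → F (x ∷ v) ≡ 0ℤ) → dsSum F m β ≡ 0ℤ
dsSum-∷-zero F zero    β F≡0 = refl
dsSum-∷-zero F (suc m) β F≡0 =
  cong₃ (λ a b c → + 2 * a - b - c) (F≡0 𝐚 _) (F≡0 𝐛 _) (dsSum-∷-zero (F ∘ (𝐚 ∷_)) m β (λ x v → F≡0 𝐚 (x ∷ v)))

dsSum-isAⁿ𝐛-𝐛 : ∀ c m β → dsSum (λ v → 𝟙 (isAⁿ𝐛 v) * c) m (𝐛 ∷ β) ≡ (1ℤ - negOnePow m) * (𝟙 (null β) * c)
dsSum-isAⁿ𝐛-𝐛 c zero    β = refl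
dsSum-isAⁿ𝐛-𝐛 c (suc m) β = begin
  + 2 * (𝟙 (isAⁿ𝐛 (as m ++ 𝐛 ∷ β)) * c) - 𝟙 (null (as m ++ 𝐛 ∷ β)) * c - dsSum (λ v → 𝟙 (isAⁿ𝐛 v) * c) m (𝐛 ∷ β)
    ≡⟨ cong₃ (λ a b d → + 2 * (𝟙 a * c) - 𝟙 b * c - d)
             (isAⁿ𝐛-as m (𝐛 ∷ β)) (null-++-∷ (as m) 𝐛 β) (dsSum-isAⁿ𝐛-𝐛 c m β) ⟩
  + 2 * X - 0ℤ - (1ℤ - negOnePow m) * X
    ≡⟨ collect X (negOnePow m) ⟩
  (1ℤ - - negOnePow m) * X ∎
  where
  X = 𝟙 (null β) * c
  collect : ∀ x s → + 2 * x - 0ℤ - (1ℤ - s) * x ≡ (1ℤ - - s) * x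
  collect = solve-∀

dsSum-isAⁿ𝐛-[] : ∀ c m → dsSum (λ v → 𝟙 (isAⁿ𝐛 v) * c) (suc m) [] ≡ negOnePow (suc m) * c
dsSum-isAⁿ𝐛-[] c zero    = atOne c
  where
  atOne : ∀ c → + 2 * 0ℤ - 1ℤ * c - 0ℤ ≡ - 1ℤ * c
  atOne = solve-∀
dsSum-isAⁿ𝐛-[] c (suc m) = begin
  + 2 * (𝟙 (isAⁿ𝐛 (as m ++ [])) * c) - 0ℤ - dsSum (λ v → 𝟙 (isAⁿ𝐛 v) * c) (suc m) []
    ≡⟨ cong₂ (λ a d → + 2 * (𝟙 a * c) - 0ℤ - d) (isAⁿ𝐛-as m []) (dsSum-isAⁿ𝐛-[] c m) ⟩
  + 2 * 0ℤ - 0ℤ - negOnePow (suc m) * c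
    ≡⟨ flip (negOnePow (suc m)) c ⟩
  - negOnePow (suc m) * c ∎
  where
  flip : ∀ s c → + 2 * 0ℤ - 0ℤ - s * c ≡ - s * c
  flip = solve-∀

module _ (P : GradedPoset) (se : SemiEulerian P) {n : ℕ} (rk-top : rk P (top P) ≡ suc n) where

  rk≡suc⇒≢bot : ∀ {y k} → rk P y ≡ suc k → y ≢ bot P
  rk≡suc⇒≢bot ry refl = ℕ.0≢1+n (trans (sym (rk-bot P)) ry)

  throughTop : ℕ → Elem P → ℤ
  throughTop _ y = 𝟙 (does (y Fin.≟ top P))

  factorsThrough-top : FactorsThrough P [] throughTop
  factorsThrough-top x k j = begin
    + flagChains P x k (as j ++ [])   ≡⟨ cong +_ (flagChains-as P x k j []) ⟩
    + flagChains P x (j ℕ.+ k) []     ≡⟨ pos-if (lt P x (top P)) 1 ⟩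
    𝟙 (lt P x (top P)) * 1ℤ           ≡⟨ ℤ.*-identityʳ _ ⟩
    𝟙 (lt P x (top P))                ≡⟨ sym (∑-allFin-𝟙-≟ (card P) (top P) (λ y → 𝟙 (lt P x y))) ⟩
    ∑[ y ← elems P ] (𝟙 (does (y Fin.≟ top P)) * 𝟙 (lt P x y))
      ≡⟨ ∑-cong (elems P) (λ y → ℤ.*-comm (𝟙 (does (y Fin.≟ top P))) (𝟙 (lt P x y))) ⟩
    ∑[ y ← elems P ] (𝟙 (lt P x y) * 𝟙 (does (y Fin.≟ top P))) ∎

  flagChainsVia𝐛 : List AB → ℕ → Elem P → ℤ
  flagChainsVia𝐛 β K y = 𝟙 (does (rk P y ℕ.≟ suc K)) * + flagChains P y (suc K) β

  factorsThrough-𝐛 : ∀ β → FactorsThrough P (𝐛 ∷ β) (flagChainsVia𝐛 β)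
  factorsThrough-𝐛 β x k j = trans (cong +_ (flagChains-as P x k j (𝐛 ∷ β))) (flagChains-𝐛 P x (j ℕ.+ k) β)

  dsSum-flagChains-vanish : ∀ x k m β → rk P x ≡ k → Flankʳ β → ¬ (β ≡ [] × x ≡ bot P) →
                            k ℕ.+ (m ℕ.+ length β) ≡ n → dsSum (λ v → + flagChains P x k v) m β ≡ 0ℤ
  dsSum-flagChains-vanish x k m [] refl [] not-full ∣xβ∣ =
    trans (dsSum-flagChains P [] throughTop factorsThrough-top x m k) (∑-zero (elems P) atTop)
    where
    atTop : ∀ y → 𝟙 (lt P x y) * (𝟙 (does (y Fin.≟ top P)) * gapSum P x (rk P x) m y) ≡ 0ℤ
    atTop y with y Fin.≟ top P
    ... | no  _    = ℤ.*-zeroʳ (𝟙 (lt P x y))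
    ... | yes refl with lt P x (top P) in x<top
    ...   | false = refl
    ...   | true  = cong (λ e → 1ℤ * (1ℤ * e))
                         (gapSum-vanish P se m x<top rk-top′ λ (x≡bot , _) → not-full (refl , x≡bot))
      where
      regroup : ∀ k m → k ℕ.+ (m ℕ.+ 0) ≡ m ℕ.+ k
      regroup = ℕ-Solver.solve-∀
      rk-top′ : rk P (top P) ≡ suc (m ℕ.+ rk P x)
      rk-top′ = trans rk-top (cong suc (trans (sym ∣xβ∣) (regroup (rk P x) m)))
  dsSum-flagChains-vanish x k m (𝐛 ∷ β) refl (start𝐛 β) _ ∣xβ∣ =
    trans (dsSum-flagChains P (𝐛 ∷ β) (flagChainsVia𝐛 β) (factorsThrough-𝐛 β) x m k) (∑-zero (elems P) atRank)
    where
    K = suc (m ℕ.+ rk P x)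
    below-top : ∀ {y} → rk P y ≡ K → rk P y ℕ.< rk P (top P)
    below-top ry = subst₂ ℕ._<_ (sym ry) (sym rk-top)
                     (ℕ.s≤s (subst (K ℕ.≤_) (trans (regroup m (rk P x) (length β)) ∣xβ∣)
                                   (ℕ.m≤m+n K (length β))))
      where
      regroup : ∀ m k b → suc (m ℕ.+ k) ℕ.+ b ≡ k ℕ.+ (m ℕ.+ suc b)
      regroup = ℕ-Solver.solve-∀
    atRank : ∀ y → 𝟙 (lt P x y) * (flagChainsVia𝐛 β (m ℕ.+ rk P x) y * gapSum P x (rk P x) m y) ≡ 0ℤ
    atRank y with lt P x y in x<y
    ... | false = refl
    ... | true  = cong (1ℤ *_) (trans (ℤ.*-assoc (𝟙 (does (rk P y ℕ.≟ K))) _ _)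
                                      (𝟙-does-* (rk P y ℕ.≟ K) _ at-rank))
      where
      at-rank : rk P y ≡ K → + flagChains P y K β * gapSum P x (rk P x) m y ≡ 0ℤ
      at-rank ry = trans (cong (+ flagChains P y K β *_) (gapSum-vanish P se m x<y ry not-full))
                         (ℤ.*-zeroʳ (+ flagChains P y K β))
        where
        not-full : ¬ (x ≡ bot P × y ≡ top P)
        not-full (_ , y≡top) = ℕ.<-irrefl (cong (rk P) y≡top) (below-top ry)

  dsSum-flagChains-𝐛 : ∀ x k α m β →
    (∀ y → lt P x y ≡ true → rk P y ≡ suc k → dsSum (λ v → + flagChains P y (suc k) (α ++ v)) m β ≡ 0ℤ) →
    dsSum (λ v → + flagChains P x k (𝐛 ∷ α ++ v)) m β ≡ 0ℤ
  dsSum-flagChains-𝐛 x k α m β above = begin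
    dsSum (λ v → + flagChains P x k (𝐛 ∷ α ++ v)) m β
      ≡⟨ dsSum-cong m β (λ v → flagChains-𝐛 P x k (α ++ v)) ⟩
    dsSum (λ v → ∑[ y ← elems P ] term y v) m β
      ≡⟨ dsSum-∑ (elems P) term m β ⟩
    ∑[ y ← elems P ] dsSum (term y) m β
      ≡⟨ ∑-zero (elems P) vanish ⟩
    0ℤ ∎
    where
    term : Elem P → List AB → ℤ
    term y v = 𝟙 (lt P x y) * (𝟙 (does (rk P y ℕ.≟ suc k)) * + flagChains P y (suc k) (α ++ v))
    vanish : ∀ y → dsSum (term y) m β ≡ 0ℤ
    vanish y = begin
      dsSum (term y) m β
        ≡⟨ dsSum-*ˡ (𝟙 (lt P x y)) _ m β ⟩
      𝟙 (lt P x y) * dsSum (λ v → 𝟙 (does (rk P y ℕ.≟ suc k)) * + flagChains P y (suc k) (α ++ v)) m β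
        ≡⟨ cong (𝟙 (lt P x y) *_) (dsSum-*ˡ (𝟙 (does (rk P y ℕ.≟ suc k))) _ m β) ⟩
      𝟙 (lt P x y) * (𝟙 (does (rk P y ℕ.≟ suc k)) * dsSum (λ v → + flagChains P y (suc k) (α ++ v)) m β)
        ≡⟨ byCases ⟩
      0ℤ ∎
      where
      byCases : 𝟙 (lt P x y) * (𝟙 (does (rk P y ℕ.≟ suc k)) * dsSum (λ v → + flagChains P y (suc k) (α ++ v)) m β)
                ≡ 0ℤ
      byCases with lt P x y in x<y
      ... | false = refl
      ... | true  = cong (1ℤ *_) (𝟙-does-* (rk P y ℕ.≟ suc k) _ (above y x<y))

  dsSum-flagChains-after : ∀ {α} → EndsWith𝐛 α → ∀ x k m β → Flankʳ β →
                           k ℕ.+ (length α ℕ.+ (m ℕ.+ length β)) ≡ n →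
                           dsSum (λ v → + flagChains P x k (α ++ v)) m β ≡ 0ℤ
  dsSum-flagChains-after [𝐛] x k m β fβ ∣α∣ = dsSum-flagChains-𝐛 x k [] m β λ y _ ry →
    dsSum-flagChains-vanish y (suc k) m β ry fβ (λ (_ , y≡bot) → rk≡suc⇒≢bot ry y≡bot)
                            (trans (sym (ℕ.+-suc k _)) ∣α∣)
  dsSum-flagChains-after (𝐚 ∷ e) x k m β fβ ∣α∣ =
    dsSum-flagChains-after e x (suc k) m β fβ (trans (sym (ℕ.+-suc k _)) ∣α∣)
  dsSum-flagChains-after {𝐛 ∷ α} (_ ∷ e) x k m β fβ ∣α∣ = dsSum-flagChains-𝐛 x k α m β λ y _ _ →
    dsSum-flagChains-after e y (suc k) m β fβ (trans (sym (ℕ.+-suc k _)) ∣α∣)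

  flagChains-DS : ∀ α m β → Flankˡ α → Flankʳ β → ¬ (α ≡ [] × β ≡ []) → length α ℕ.+ (m ℕ.+ length β) ≡ n →
                  dsSum (λ v → + flagChains P (bot P) 0 (α ++ v)) m β ≡ 0ℤ
  flagChains-DS [] m β []       fβ not-full ∣αβ∣ =
    dsSum-flagChains-vanish (bot P) 0 m β (rk-bot P) fβ (λ (β≡[] , _) → not-full (refl , β≡[])) ∣αβ∣
  flagChains-DS α  m β (end𝐛 e) fβ _        ∣αβ∣ = dsSum-flagChains-after e (bot P) 0 m β fβ ∣αβ∣

  bot<top : lt P (bot P) (top P) ≡ true
  bot<top = le∧≢⇒lt P (Equivalence.to T-≡ (bot-min P (top P)))
                      (λ bot≡top → ℕ.0≢1+n (trans (sym (rk-bot P)) (trans (cong (rk P) bot≡top) rk-top)))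

  ∑open-bot-top : ∑open P (bot P) (top P) (sgn P) ≡ signSumAbove P (bot P) (top P) 0
  ∑open-bot-top =
    trans (sym (signSumAbove-rk P (bot P) (top P))) (cong (signSumAbove P (bot P) (top P)) (rk-bot P))

  eulerChar-∑open : eulerChar P n ≡ - ∑open P (bot P) (top P) (sgn P)
  eulerChar-∑open = begin
    eulerChar P n
      ≡⟨ sumℤ-map (upTo n) (λ j → negOnePow j * + chainsFrom P (bot P) (suc j ∷ [])) ⟩
    ∑[ j ← upTo n ] (negOnePow j * + chainsFrom P (bot P) (suc j ∷ []))
      ≡⟨ ∑-cong (upTo n) (λ j → cong (negOnePow j *_) (rankCount-single j)) ⟩
    S
      ≡⟨ isolate (signSumAbove P (bot P) (top P) n) S ⟩
    O n - (O n - S)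
      ≡⟨ cong₂ (λ a b → a - b) (signSumAbove-below-rk P (bot P) (top P) n rk-top)
                               (sym (signSumAbove-telescope P (bot P) (top P) n)) ⟩
    0ℤ - O 0
      ≡⟨ trans (ℤ.+-identityˡ _) (cong -_ (sym ∑open-bot-top)) ⟩
    - ∑open P (bot P) (top P) (sgn P) ∎
    where
    O = signSumAbove P (bot P) (top P)
    S = ∑[ j ← upTo n ] (negOnePow j * rankCount P (bot P) (suc j) (top P))
    isolate : ∀ o s → s ≡ o - (o - s)
    isolate = solve-∀
    rankCount-single : ∀ j → + chainsFrom P (bot P) (suc j ∷ []) ≡ rankCount P (bot P) (suc j) (top P)
    rankCount-single j =
      trans (flagChains-𝐛 P (bot P) j []) (∑-cong (elems P) (λ y → cong (𝟙 (lt P (bot P) y) *_) (swap y)))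
      where
      swap : ∀ y → 𝟙 (does (rk P y ℕ.≟ suc j)) * + flagChains P y (suc j) []
                   ≡ 𝟙 (lt P y (top P)) * 𝟙 (does (rk P y ℕ.≟ suc j))
      swap y = trans (cong (𝟙 (does (rk P y ℕ.≟ suc j)) *_)
                           (trans (pos-if (lt P y (top P)) 1) (ℤ.*-identityʳ (𝟙 (lt P y (top P))))))
                     (ℤ.*-comm (𝟙 (does (rk P y ℕ.≟ suc j))) (𝟙 (lt P y (top P))))

  eulerDefect : ℤ
  eulerDefect = chiSphere n - eulerChar P n

  dsSum-flagChains-full : dsSum (λ v → + flagChains P (bot P) 0 v) n [] ≡ eulerDefect
  dsSum-flagChains-full = begin
    dsSum (λ v → + flagChains P (bot P) 0 v) n []
      ≡⟨ dsSum-flagChains P [] throughTop factorsThrough-top (bot P) n 0 ⟩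
    ∑[ y ← elems P ] (𝟙 (lt P (bot P) y) * (𝟙 (does (y Fin.≟ top P)) * E y))
      ≡⟨ ∑-cong (elems P) (λ y → swap (𝟙 (lt P (bot P) y)) (𝟙 (does (y Fin.≟ top P))) (E y)) ⟩
    ∑[ y ← elems P ] (𝟙 (does (y Fin.≟ top P)) * (𝟙 (lt P (bot P) y) * E y))
      ≡⟨ ∑-allFin-𝟙-≟ (card P) (top P) (λ y → 𝟙 (lt P (bot P) y) * E y) ⟩
    𝟙 (lt P (bot P) (top P)) * E (top P)
      ≡⟨ cong (λ b → 𝟙 b * E (top P)) bot<top ⟩
    1ℤ * E (top P)
      ≡⟨ gapSum-signSum P (bot P) (top P) n 0 (trans rk-top (cong suc (sym (ℕ.+-identityʳ n)))) ⟩
    1ℤ + (sgn P (top P) + signSumAbove P (bot P) (top P) 0)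
      ≡⟨ cong₂ (λ s o → 1ℤ + (s + o)) (cong negOnePow rk-top) (sym ∑open-bot-top) ⟩
    1ℤ + (- negOnePow n + ∑open P (bot P) (top P) (sgn P))
      ≡⟨ regroup (negOnePow n) (∑open P (bot P) (top P) (sgn P)) ⟩
    chiSphere n - - ∑open P (bot P) (top P) (sgn P)
      ≡⟨ cong (_-_ (chiSphere n)) (sym eulerChar-∑open) ⟩
    eulerDefect ∎
    where
    E : Elem P → ℤ
    E = gapSum P (bot P) 0 n
    swap : ∀ a b e → a * (b * e) ≡ b * (a * e)
    swap = solve-∀
    regroup : ∀ s o → 1ℤ + (- s + o) ≡ 1ℤ - s - - o
    regroup = solve-∀

  -- For n even, sgn 1̂ = -1 and the Euler relations of [0̂, y] and [y, 1̂] give B y - A y = 2 for every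
  -- 0̂ < y < 1̂; but ∑ sgn(y) A y and ∑ sgn(y) B y both count the pairs 0̂ < z < y < 1̂ with sign sgn z sgn y.
  ∑open-bot-top-even : evenB n ≡ true → ∑open P (bot P) (top P) (sgn P) ≡ 0ℤ
  ∑open-bot-top-even n-even = ℤ.*-cancelˡ-≡ (+ 2) W 0ℤ (begin
    + 2 * W                                  ≡⟨ sym (∑-*ˡ (elems P) (+ 2) w) ⟩
    ∑[ y ← elems P ] (+ 2 * w y)             ≡⟨ sym (∑-cong (elems P) difference) ⟩
    ∑[ y ← elems P ] (w y * (B y - A y))     ≡⟨ ∑-cong (elems P) (λ y → distrib (w y) (B y) (A y)) ⟩
    ∑[ y ← elems P ] (w y * B y - w y * A y) ≡⟨ ∑-sub (elems P) (λ y → w y * B y) (λ y → w y * A y) ⟩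
    ∑ (elems P) (λ y → w y * B y) - ∑ (elems P) (λ y → w y * A y)
      ≡⟨ cong (_- ∑ (elems P) (λ y → w y * A y)) pairs ⟩
    ∑ (elems P) (λ y → w y * A y) - ∑ (elems P) (λ y → w y * A y)
      ≡⟨ ℤ.+-inverseʳ (∑ (elems P) (λ y → w y * A y)) ⟩
    0ℤ                                       ≡⟨ sym (ℤ.*-zeroʳ (+ 2)) ⟩
    + 2 * 0ℤ                                 ∎)
    where
    W = ∑open P (bot P) (top P) (sgn P)
    g : Elem P → ℤ
    g y = 𝟙 (lt P y (top P)) * sgn P y
    w : Elem P → ℤ
    w y = 𝟙 (lt P (bot P) y) * g y
    A B : Elem P → ℤ
    A y = ∑open P (bot P) y (sgn P)
    B y = ∑open P y (top P) (sgn P)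
    distrib : ∀ w b a → w * (b - a) ≡ w * b - w * a
    distrib = solve-∀
    difference : ∀ y → w y * (B y - A y) ≡ + 2 * w y
    difference y = byCases (lt P (bot P) y) (lt P y (top P)) refl refl
      where
      byCases : ∀ a b → lt P (bot P) y ≡ a → lt P y (top P) ≡ b →
                𝟙 a * (𝟙 b * sgn P y) * (B y - A y) ≡ + 2 * (𝟙 a * (𝟙 b * sgn P y))
      byCases false _     _     _     = refl
      byCases true  false _     _     = refl
      byCases true  true  bot<y y<top = begin
        v * (B y - A y)       ≡⟨ cong (v *_) (two (sgn P y) (B y) (A y)) ⟩
        v * (+ 2 + (sgn P y + (sgn P (top P) + B y)) - (sgn P (bot P) + (sgn P y + A y)))
          ≡⟨ cong₂ (λ b a → v * (+ 2 + b - a)) (euler-open P se y<top λ (y≡bot , _) → lt⇒≢ P bot<y (sym y≡bot))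
                                              (euler-open P se bot<y λ (_ , y≡top) → lt⇒≢ P y<top y≡top) ⟩
        v * + 2               ≡⟨ ℤ.*-comm v (+ 2) ⟩
        + 2 * v               ∎
        where
        v = 1ℤ * (1ℤ * sgn P y)
        sgn-bot : sgn P (bot P) ≡ 1ℤ
        sgn-bot = cong negOnePow (rk-bot P)
        sgn-top : sgn P (top P) ≡ - 1ℤ
        sgn-top = trans (cong negOnePow rk-top) (cong -_ (negOnePow-even n n-even))
        two : ∀ s b a → b - a ≡ + 2 + (s + (sgn P (top P) + b)) - (sgn P (bot P) + (s + a))
        two s b a = trans (solved s b a)
                          (sym (cong₂ (λ t u → + 2 + (s + (t + b)) - (u + (s + a))) sgn-top sgn-bot))
          where
          solved : ∀ s b a → b - a ≡ + 2 + (s + (- 1ℤ + b)) - (1ℤ + (s + a))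
          solved = solve-∀
    restrict : ∀ {y} → lt P y (top P) ≡ true → ∑open P (bot P) y g ≡ A y
    restrict {y} y<top = ∑-cong (elems P) below
      where
      below : ∀ z → 𝟙 (lt P (bot P) z) * (𝟙 (lt P z y) * g z) ≡ 𝟙 (lt P (bot P) z) * (𝟙 (lt P z y) * sgn P z)
      below z with lt P z y in z<y
      ... | false = refl
      ... | true  = cong (λ u → 𝟙 (lt P (bot P) z) * (1ℤ * u))
                         (trans (cong (λ b → 𝟙 b * sgn P z) (lt-trans P z<y y<top)) (ℤ.*-identityˡ (sgn P z)))
    pairs : ∑ (elems P) (λ y → w y * B y) ≡ ∑ (elems P) (λ y → w y * A y)
    pairs = begin
      ∑[ y ← elems P ] (w y * B y)
        ≡⟨ ∑-cong (elems P) (λ y → ℤ.*-assoc (𝟙 (lt P (bot P) y)) (g y) (B y)) ⟩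
      ∑[ y ← elems P ] (𝟙 (lt P (bot P) y) * (g y * B y))        ≡⟨ ∑-swap-chain P (bot P) g g ⟩
      ∑[ y ← elems P ] (𝟙 (lt P (bot P) y) * (g y * ∑open P (bot P) y g)) ≡⟨ ∑-cong (elems P) inner ⟩
      ∑[ y ← elems P ] (w y * A y)                               ∎
      where
      inner : ∀ y → 𝟙 (lt P (bot P) y) * (g y * ∑open P (bot P) y g) ≡ w y * A y
      inner y with lt P y (top P) in y<top
      ... | false = vanish (𝟙 (lt P (bot P) y)) (∑open P (bot P) y g) (A y)
        where
        vanish : ∀ a x y → a * (0ℤ * x) ≡ a * 0ℤ * y
        vanish = solve-∀
      ... | true  = trans (cong (λ o → 𝟙 (lt P (bot P) y) * (1ℤ * sgn P y * o)) (restrict y<top))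
                          (sym (ℤ.*-assoc (𝟙 (lt P (bot P) y)) (1ℤ * sgn P y) (A y)))

  eulerDefect-sign : negOnePow n * eulerDefect ≡ - eulerDefect
  eulerDefect-sign with evenB n in n-parity
  ... | true  = trans (cong (negOnePow n *_) δ≡0) (trans (ℤ.*-zeroʳ (negOnePow n)) (cong -_ (sym δ≡0)))
    where
    δ≡0 : eulerDefect ≡ 0ℤ
    δ≡0 = begin
      chiSphere n - eulerChar P n                   ≡⟨ cong₂ (λ s e → 1ℤ - s - e) (negOnePow-even n n-parity) eulerChar-∑open ⟩
      1ℤ - 1ℤ - - ∑open P (bot P) (top P) (sgn P)  ≡⟨ cong (λ w → 1ℤ - 1ℤ - - w) (∑open-bot-top-even n-parity) ⟩
      0ℤ                                            ∎
  ... | false = trans (cong (_* eulerDefect) (negOnePow-odd n n-parity)) (ℤ.-1*i≡-i eulerDefect)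

  modifiedFlag : List AB → ℤ
  modifiedFlag u = + flagChains P (bot P) 0 u + 𝟙 (isAⁿ𝐛 u) * eulerDefect

  modifiedFlag-DS : DehnSommerville n modifiedFlag
  modifiedFlag-DS α m β fα fβ ∣αβ∣ =
    trans (dsSum-+ (λ v → + flagChains P (bot P) 0 (α ++ v)) (λ v → 𝟙 (isAⁿ𝐛 (α ++ v)) * eulerDefect) m β)
          (byFlanks α m β fα fβ ∣αβ∣)
    where
    δ = eulerDefect
    byFlanks : ∀ α m β → Flankˡ α → Flankʳ β → length α ℕ.+ (m ℕ.+ length β) ≡ n →
               dsSum (λ v → + flagChains P (bot P) 0 (α ++ v)) m β + dsSum (λ v → 𝟙 (isAⁿ𝐛 (α ++ v)) * δ) m β
               ≡ 0ℤ
    byFlanks α m β (end𝐛 e) fβ ∣αβ∣ =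
      cong₂ _+_ (flagChains-DS α m β (end𝐛 e) fβ (λ { (refl , _) → case e of λ () }) ∣αβ∣)
                (dsSum-∷-zero _ m β (λ x v → cong (λ b → 𝟙 b * δ) (isAⁿ𝐛-after e x v)))
    byFlanks [] zero [] [] [] _ = refl
    byFlanks [] (suc m) [] [] [] ∣m∣ = begin
      dsSum (λ v → + flagChains P (bot P) 0 v) (suc m) [] + dsSum (λ v → 𝟙 (isAⁿ𝐛 v) * δ) (suc m) []
        ≡⟨ cong₂ _+_ (subst (λ k → dsSum (λ v → + flagChains P (bot P) 0 v) k [] ≡ δ) (sym m+1≡n)
                            dsSum-flagChains-full)
                     (trans (dsSum-isAⁿ𝐛-[] δ m) (trans (cong (λ k → negOnePow k * δ) m+1≡n) eulerDefect-sign)) ⟩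
      δ - δ ≡⟨ ℤ.+-inverseʳ δ ⟩
      0ℤ ∎
      where
      m+1≡n : suc m ≡ n
      m+1≡n = trans (sym (ℕ.+-identityʳ (suc m))) ∣m∣
    byFlanks [] m (𝐛 ∷ β) [] (start𝐛 β) ∣mβ∣ =
      trans (cong₂ _+_ (flagChains-DS [] m (𝐛 ∷ β) [] (start𝐛 β) (λ ()) ∣mβ∣) (dsSum-isAⁿ𝐛-𝐛 δ m β))
            (trans (ℤ.+-identityˡ _) (vanish β ∣mβ∣))
      where
      vanish : ∀ β → m ℕ.+ suc (length β) ≡ n → (1ℤ - negOnePow m) * (𝟙 (null β) * δ) ≡ 0ℤ
      vanish (_ ∷ _) _   = ℤ.*-zeroʳ (1ℤ - negOnePow m)
      vanish []      ∣m∣ = begin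
        (1ℤ - negOnePow m) * (1ℤ * δ)  ≡⟨ expand (negOnePow m) δ ⟩
        δ + - negOnePow m * δ          ≡⟨ cong (λ k → δ + negOnePow k * δ) (trans (ℕ.+-comm 1 m) ∣m∣) ⟩
        δ + negOnePow n * δ            ≡⟨ cong (_+_ δ) eulerDefect-sign ⟩
        δ - δ                          ≡⟨ ℤ.+-inverseʳ δ ⟩
        0ℤ                             ∎
        where
        expand : ∀ s d → (1ℤ - s) * (1ℤ * d) ≡ d + - s * d
        expand = solve-∀

  modifiedFlag-flagF′ : ∀ (S : Vec Bool n) → flagF' P n S ≡ modifiedFlag (uS S)
  modifiedFlag-flagF′ S with ≡-dec ℕ._≟_ (ranks S) (n ∷ [])
  ... | yes top-rank = cong₂ _+_ (cong +_ (chainsFrom-ranksFrom P (bot P) 0 S))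
                                 (sym (trans (cong (λ b → 𝟙 b * eulerDefect) (ranksFrom-isAⁿ𝐛 0 S top-rank))
                                             (ℤ.*-identityˡ eulerDefect)))
  ... | no  other    = trans (sym (ℤ.+-identityʳ _))
                             (cong₂ _+_ (cong +_ (chainsFrom-ranksFrom P (bot P) 0 S))
                                        (cong (λ b → 𝟙 b * eulerDefect)
                                              (sym (¬-not (other ∘ isAⁿ𝐛-ranksFrom 0 S)))))

  chainPoly′≡wordPoly : chainPoly' P n ≡ wordPoly n modifiedFlag
  chainPoly′≡wordPoly = map-cong (λ S → cong (_, uS S) (modifiedFlag-flagF′ S)) (allSubsets n)

theorem3p3 : (n : ℕ) (P : GradedPoset) → rk P (top P) ≡ suc n → SemiEulerian P →
    Σ (NCPoly CD) (λ Φ → substₚ σcd Φ ≈⟨ _≟AB_ ⟩ substₚ σab (chainPoly' P n))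
theorem3p3 n P rk-top se = cdIndex n F′ , λ w → begin
  coeffAB (substₚ σcd (cdIndex n F′)) w    ≡⟨ cdIndex-flagH n F′ (modifiedFlag-DS P se rk-top) w ⟩
  flagH n F′ w                              ≡⟨ sym (coeff-σab-wordPoly n F′ w) ⟩
  coeffAB (substₚ σab (wordPoly n F′)) w
    ≡⟨ cong (λ p → coeffAB (substₚ σab p) w) (sym (chainPoly′≡wordPoly P se rk-top)) ⟩
  coeffAB (substₚ σab (chainPoly' P n)) w  ∎
  where
  F′ = modifiedFlag P se rk-top
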